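{- Let $\alpha:A^{\Delta}\to(H,V)$ be a homomorphism into a finite forest algebra whose horizontal monoid $H$ is idempotent and commutative. Then $\alpha$ is an $(\mathsf{EF},\mathsf{EX})$-homomorphism if and only if it is nonconfusing.
   Context: $A^{\Delta}=(H_A,V_A)$ is the free forest algebra over the finite alphabet $A$: $H_A$ is the monoid of forests (finite ordered sequences of finite ordered $A$-labelled trees) under concatenation $+$; $V_A$ the monoid of contexts (forests with one leaf replaced by a hole) under substitution, acting on $H_A$ by substitution. $as$ denotes the tree with root $a$ and child forest $s$. A forest algebra $(H,V)$ is an additive monoid $H$, a monoid $V$, and a faithful left action of $V$ on $H$ such that the maps $g\mapsto g+h$, $g\mapsto h+g$ lie in $V$; homomorphisms preserve everything and homomorphisms from $A^{\Delta}$ are determined by the images of $a\square$. When $H$ is idempotent and commutative, the sum $\infty$ of all its elements is absorbing. $\beta$ factors through $\alpha$ if $\alpha(s)=\alpha(s')$ implies $\beta(s)=\beta(s')$ for forests $s,s'$. Wreath product: $(H_1,V_1)\circ(H_2,V_2)=(H_1\times H_2,V_1\times V_2^{H_1})$, componentwise addition, $(v,f)(h_1,h_2)=(vh_1,f(h_1)h_2)$. For $\alpha:A^{\Delta}\to(H_1,V_1)$, $\beta:(A\times H_1)^{\Delta}\to(H_2,V_2)$, $\alpha\otimes\beta(a)=(\alpha(a),h\mapsto\beta(a,h))$; then $\alpha\otimes\beta(s)=(\alpha(s),\beta(s^{\alpha}))$ where $s^{\alpha}$ relabels each node whose subtree is $at$ by $(a,\alpha(t))$. Iterated products $\beta_1\otimes\cdots\otimes\beta_k$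 with $\beta_i:(A\times H_1\times\cdots\times H_{i-1})^{\Delta}\to(H_i,V_i)$ are formed likewise. A homomorphism is 1-definite if the value of a forest depends only on the set of labels of its root nodes. ${\cal U}_1=(\{0,\infty\},\{1,0\})$, $1$ the identity, $0$ the constant map to $\infty$. An $(\mathsf{EF},\mathsf{EX})$-homomorphism is one that factors through some $\beta_1\otimes\cdots\otimes\beta_k$ where each $\beta_i$ maps into ${\cal U}_1$ or is 1-definite. Reachability: $h\le h'$ iff $h=vh'$ for some $v\in V$; reachability classes are the classes of $h\cong h'$ (both $h\le h'$ and $h'\le h$), partially ordered by $\le$; $h>\Gamma$ means the class of $h$ is strictly above $\Gamma$. For a class $\Gamma$, let $I_\Gamma=\{h\in H:h\not>\Gamma\}$ and let $\alpha_\Gamma:A^{\Delta}\to(H_\Gamma,V_\Gamma)$ be the quotient of $\alpha$ in which all elements of $I_\Gamma$ are identified to a single (absorbing) element $\infty$ (forests $s,s'$ identified iff $\alpha(s)=\alpha(s')\notin I_\Gamma$ or $\alpha(s),\alpha(s')\in I_\Gamma$). For any finite alphabet $B$, equivalences $\sim_k$ on $H_B$: $\sim_0$ identifies all forests; for $s=b_1s_1+\cdots+b_rs_r$, let $T^{k+1}_s=\{(b_i,[s_i]_{\sim_k}):1\le i\le r\}$ and $s\sim_{k+1}s'$ iff $T^{k+1}_s=T^{k+1}_{s'}$. For $k>0$ and a reachability class $\Gamma$, forests $s_1,s_2\in H_A$ satisfy $s_1\equiv_{\alpha,k,\Gamma}s_2$ if $(s_1)^{\alpha_\Gamma}\sim_k(s_2)^{\alpha_\Gamma}$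 (as forests over $A\times H_\Gamma$) and $\alpha(s_1),\alpha(s_2)\in\Gamma$. $\alpha$ is nonconfusing (with parameter $k$) if there is $k>0$ such that for every reachability class $\Gamma$, $s_1\equiv_{\alpha,k,\Gamma}s_2$ implies $\alpha(s_1)=\alpha(s_2)$.
   Formalization: The homomorphism α is assumed to be onto (on both H and V); without this the claim fails, since extra elements of V can merge reachability classes, e.g. H={0,∞}, V all maps on H, α(a□) constant ∞, α(b□) the identity. -}

module Defs where

open import Algebra.Bundles using (Monoid)
open import Algebra.Morphism.Structures using (module MonoidMorphisms)
open import Algebra.Structures using (IsMonoid)
open import Data.Bool.Base using (Bool; true; false; not; _∨_)
open import Data.Bool.Properties using (∧-isMonoid; ∨-isMonoid; ∨-identityʳ; ∨-zeroʳ)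
open import Data.Empty using (⊥-elim)
open import Data.Fin.Base using (Fin)
open import Data.Fin.Properties using (any?) renaming (_≟_ to _≟ᶠ_)
open import Data.List.Base using (List; []; _∷_; _++_; map; length)
open import Data.List.Properties using (++-assoc; ++-identityʳ; ++-isMonoid; ++-cancelˡ; ∷-injective; length-++)
open import Data.Nat.Base using (ℕ; zero; suc; s≤s) renaming (_+_ to _+ℕ_; _<_ to _<ℕ_; _≤_ to _≤ℕ_)
open import Data.Nat.Properties using (≤-trans; m≤m+n; m≤n+m; <-irrefl; <-≤-trans; ≤-<-trans; m+1+n≢m; +-suc; +-comm) renaming (+-assoc to +ℕ-assoc)
open import Data.Product.Base using (Σ; ∃; _×_; _,_; proj₁; proj₂)
open import Data.Product.Relation.Binary.Pointwise.NonDependent using (×-setoid)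
open import Data.Unit.Base using (⊤)
open import Function.Base using (_∘_; id)
open import Function.Bundles using (Inverse)
open import Function.Definitions using (Surjective)
open import Level using (0ℓ)
open import Relation.Binary.Bundles using (Setoid)
open import Relation.Binary.Definitions using (Decidable; DecidableEquality)
open import Relation.Binary.PropositionalEquality.Core using (_≡_; refl; sym; trans; cong; cong₂)
open import Relation.Binary.PropositionalEquality.Properties using (setoid; isEquivalence; module ≡-Reasoning)
open import Relation.Binary.Structures using (IsEquivalence)
open import Relation.Nullary.Decidable.Core using (Dec; yes; no; map′; _×-dec_; ¬?; recompute)
open import Relation.Nullary.Negation.Core using (¬_)

import Data.List.Relation.Binary.Subset.Setoid as SetoidSubset

open ≡-Reasoning

Finite : Setoid 0ℓ 0ℓ → Set
Finite S = ∃ λ n → Inverse S (setoid (Fin n))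

-- Equality of the sets of entries of two lists.
SetEq : (S : Setoid 0ℓ 0ℓ) → List (Setoid.Carrier S) → List (Setoid.Carrier S) → Set
SetEq S xs ys = (xs ⊆ ys) × (ys ⊆ xs)
  where open SetoidSubset S using (_⊆_)

-- The vertical monoid carries its own equality because the wreath product has
-- the function space V₂^H₁ as a component of its vertical monoid.
record ForestAlgebra : Set₁ where
  infixl 6 _+_
  infixr 7 _·_
  field
    H          : Set
    _+_        : H → H → H
    0#         : H
    +-isMonoid : IsMonoid _≡_ _+_ 0#
    V-monoid   : Monoid 0ℓ 0ℓ

  +-monoid : Monoid 0ℓ 0ℓ
  +-monoid = record { isMonoid = +-isMonoid }

  open IsMonoid +-isMonoid public
    using () renaming (assoc to +-assoc; identityˡ to +-identityˡ; identityʳ to +-identityʳ)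
  open Monoid V-monoid public
    using (_≈_; _∙_) renaming (Carrier to V; ε to 1#; setoid to V-setoid)

  field
    _·_       : V → H → H
    ·-cong    : ∀ {v w} → v ≈ w → ∀ h → v · h ≡ w · h
    ·-identity : ∀ h → 1# · h ≡ h
    ·-assoc   : ∀ v w h → (v ∙ w) · h ≡ v · w · h
    faithful  : ∀ {v w} → (∀ h → v · h ≡ w · h) → v ≈ w
    [_+□]     : H → V
    [□+_]     : H → V
    +□-act    : ∀ h g → [ h +□] · g ≡ h + g
    □+-act    : ∀ h g → [□+ h ] · g ≡ g + h

record IsFinite (F : ForestAlgebra) : Set where
  open ForestAlgebra F
  field
    H-finite : Finite (setoid H)
    V-finite : Finite V-setoid

record Hom (F G : ForestAlgebra) : Set where
  private
    module F = ForestAlgebra F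
    module G = ForestAlgebra G
  field
    onH      : F.H → G.H
    onV      : F.V → G.V
    onH-homo : MonoidMorphisms.IsMonoidHomomorphism
                 (Monoid.rawMonoid F.+-monoid) (Monoid.rawMonoid G.+-monoid) onH
    onV-homo : MonoidMorphisms.IsMonoidHomomorphism
                 (Monoid.rawMonoid F.V-monoid) (Monoid.rawMonoid G.V-monoid) onV
    ·-homo   : ∀ v h → onH (v F.· h) ≡ onV v G.· onH h
    +□-homo  : ∀ h → onV F.[ h +□] G.≈ G.[ onH h +□]
    □+-homo  : ∀ h → onV F.[□+ h ] G.≈ G.[□+ onH h ]

open Hom public using (onH; onV)

-- Reachability in the target algebra is meaningful for α only when α is onto:
-- extra elements of V may merge reachability classes.
record IsSurjective {F G : ForestAlgebra} (α : Hom F G) : Set where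
  private
    module F = ForestAlgebra F
    module G = ForestAlgebra G
  field
    onH-surjective : Surjective _≡_ _≡_ (onH α)
    onV-surjective : Surjective F._≈_ G._≈_ (onV α)

module _ {F G K : ForestAlgebra} where
  private
    module G = ForestAlgebra G
    module K = ForestAlgebra K

  infixr 9 _∘ʰ_
  _∘ʰ_ : Hom G K → Hom F G → Hom F K
  ψ ∘ʰ φ = record
    { onH = ψ.onH ∘ φ.onH
    ; onV = ψ.onV ∘ φ.onV
    ; onH-homo = record
      { isMagmaHomomorphism = record
        { isRelHomomorphism = record { cong = cong (ψ.onH ∘ φ.onH) }
        ; homo = λ x y → trans (cong ψ.onH (φH.homo x y)) (ψH.homo _ _)
        }
      ; ε-homo = trans (cong ψ.onH φH.ε-homo) ψH.ε-homo
      }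
    ; onV-homo = record
      { isMagmaHomomorphism = record
        { isRelHomomorphism = record { cong = ψV.⟦⟧-cong ∘ φV.⟦⟧-cong }
        ; homo = λ x y → KV.trans (ψV.⟦⟧-cong (φV.homo x y)) (ψV.homo _ _)
        }
      ; ε-homo = KV.trans (ψV.⟦⟧-cong φV.ε-homo) ψV.ε-homo
      }
    ; ·-homo = λ v h → trans (cong ψ.onH (φ.·-homo v h)) (ψ.·-homo _ _)
    ; +□-homo = λ h → KV.trans (ψV.⟦⟧-cong (φ.+□-homo h)) (ψ.+□-homo _)
    ; □+-homo = λ h → KV.trans (ψV.⟦⟧-cong (φ.□+-homo h)) (ψ.□+-homo _)
    }
    where
    module φ = Hom φ
    module ψ = Hom ψ
    module φH = MonoidMorphisms.IsMonoidHomomorphism φ.onH-homo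
    module φV = MonoidMorphisms.IsMonoidHomomorphism φ.onV-homo
    module ψH = MonoidMorphisms.IsMonoidHomomorphism ψ.onH-homo
    module ψV = MonoidMorphisms.IsMonoidHomomorphism ψ.onV-homo
    module KV = Monoid K.V-monoid

data Tree (A : Set) : Set where
  node : A → List (Tree A) → Tree A

Forest : Set → Set
Forest A = List (Tree A)

label : ∀ {A} → Tree A → A
label (node a _) = a

children : ∀ {A} → Tree A → Forest A
children (node _ s) = s

-- hole s t is s + □ + t, and nest s a p t is s + a p + t.
data Context (A : Set) : Set where
  hole : Forest A → Forest A → Context A
  nest : Forest A → A → Context A → Forest A → Context A

module _ {A : Set} where

  fill : Context A → Forest A → Forest A
  fill (hole l r)     s = l ++ s ++ r
  fill (nest l a p r) s = l ++ node a (fill p s) ∷ r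

  surround : Forest A → Context A → Forest A → Context A
  surround l (hole l′ r′)     r = hole (l ++ l′) (r′ ++ r)
  surround l (nest l′ a p r′) r = nest (l ++ l′) a p (r′ ++ r)

  infixr 9 _⊙_
  _⊙_ : Context A → Context A → Context A
  hole l r     ⊙ q = surround l q r
  nest l a p r ⊙ q = nest l a (p ⊙ q) r

  ++-regroup : (l l′ x r′ r : Forest A) →
               (l ++ l′) ++ x ++ r′ ++ r ≡ l ++ (l′ ++ x ++ r′) ++ r
  ++-regroup l l′ x r′ r = begin
    (l ++ l′) ++ x ++ r′ ++ r   ≡⟨ ++-assoc l l′ _ ⟩
    l ++ l′ ++ x ++ r′ ++ r     ≡⟨ cong (λ z → l ++ l′ ++ z) (++-assoc x r′ r) ⟨
    l ++ l′ ++ (x ++ r′) ++ r   ≡⟨ cong (l ++_) (++-assoc l′ (x ++ r′) r) ⟨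
    l ++ (l′ ++ x ++ r′) ++ r   ∎

  fill-surround : ∀ l p r s → fill (surround l p r) s ≡ l ++ fill p s ++ r
  fill-surround l (hole l′ r′)     r s = ++-regroup l l′ s r′ r
  fill-surround l (nest l′ a p r′) r s = ++-regroup l l′ (node a (fill p s) ∷ []) r′ r

  fill-⊙ : ∀ p q s → fill (p ⊙ q) s ≡ fill p (fill q s)
  fill-⊙ (hole l r)     q s = fill-surround l q r s
  fill-⊙ (nest l a p r) q s = cong (λ z → l ++ node a z ∷ r) (fill-⊙ p q s)

  surround-surround : ∀ l l′ p r′ r →
                      surround (l ++ l′) p (r′ ++ r) ≡ surround l (surround l′ p r′) r
  surround-surround l l′ (hole l″ r″) r′ r =
    cong₂ hole (++-assoc l l′ l″) (sym (++-assoc r″ r′ r))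
  surround-surround l l′ (nest l″ a p r″) r′ r =
    cong₂ (λ x y → nest x a p y) (++-assoc l l′ l″) (sym (++-assoc r″ r′ r))

  surround-⊙ : ∀ l p r q → surround l p r ⊙ q ≡ surround l (p ⊙ q) r
  surround-⊙ l (hole l′ r′)     r q = surround-surround l l′ q r′ r
  surround-⊙ l (nest l′ a p r′) r q = refl

  ⊙-assoc : ∀ p q r → (p ⊙ q) ⊙ r ≡ p ⊙ (q ⊙ r)
  ⊙-assoc (hole l r)     q q′ = surround-⊙ l q r q′
  ⊙-assoc (nest l a p r) q q′ = cong (λ z → nest l a z r) (⊙-assoc p q q′)

  ⊙-identityˡ : ∀ p → hole [] [] ⊙ p ≡ p
  ⊙-identityˡ (hole l r)     = cong (hole l) (++-identityʳ r)
  ⊙-identityˡ (nest l a p r) = cong (nest l a p) (++-identityʳ r)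

  ⊙-identityʳ : ∀ p → p ⊙ hole [] [] ≡ p
  ⊙-identityʳ (hole l r)     = cong (λ z → hole z r) (++-identityʳ l)
  ⊙-identityʳ (nest l a p r) = cong (λ z → nest l a z r) (⊙-identityʳ p)

  ⊙-isMonoid : IsMonoid _≡_ _⊙_ (hole [] [])
  ⊙-isMonoid = record
    { isSemigroup = record
      { isMagma = record { isEquivalence = isEquivalence ; ∙-cong = cong₂ _⊙_ }
      ; assoc = ⊙-assoc
      }
    ; identity = ⊙-identityˡ , ⊙-identityʳ
    }

  private
    mutual
      sizeᵗ : Tree A → ℕ
      sizeᵗ (node _ s) = suc (size s)

      size : Forest A → ℕ
      size []      = 0
      size (t ∷ s) = sizeᵗ t +ℕ size s

    size-++ : ∀ s t → size (s ++ t) ≡ size s +ℕ size t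
    size-++ []      t = refl
    size-++ (x ∷ s) t = trans (cong (sizeᵗ x +ℕ_) (size-++ s t))
                              (sym (+ℕ-assoc (sizeᵗ x) (size s) (size t)))

    size-fill : ∀ p s → size s ≤ℕ size (fill p s)
    size-fill (hole l r) s rewrite size-++ l (s ++ r) | size-++ s r =
      ≤-trans (m≤m+n (size s) (size r)) (m≤n+m _ (size l))
    size-fill (nest l a p r) s rewrite size-++ l (node a (fill p s) ∷ r) =
      ≤-trans (size-fill p s)
        (≤-trans (m≤n+m _ 1) (≤-trans (m≤m+n _ (size r)) (m≤n+m _ (size l))))

    node-injective : ∀ {a b : A} {s t} → node a s ≡ node b t → a ≡ b × s ≡ t
    node-injective refl = refl , refl

    split : ∀ l l′ {x x′ r r′} → l ++ x ∷ r ≡ l′ ++ x′ ∷ r′ →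
            size l <ℕ sizeᵗ x′ → size l′ <ℕ sizeᵗ x → l ≡ l′ × x ≡ x′ × r ≡ r′
    split []      []       eq _ _ = refl , ∷-injective eq
    split []      (y ∷ l′) eq _ lt with refl , _ ← ∷-injective eq =
      ⊥-elim (<-irrefl refl (≤-<-trans (m≤m+n (sizeᵗ y) (size l′)) lt))
    split (y ∷ l) []       eq lt _ with refl , _ ← ∷-injective eq =
      ⊥-elim (<-irrefl refl (≤-<-trans (m≤m+n (sizeᵗ y) (size l)) lt))
    split (y ∷ l) (z ∷ l′) eq lt lt′
      with refl , eq′ ← ∷-injective eq
      with refl , e   ← split l l′ eq′ (≤-<-trans (m≤n+m (size l) (sizeᵗ y)) lt)
                                       (≤-<-trans (m≤n+m (size l′) (sizeᵗ z)) lt′) =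
      refl , e

    big : A → Forest A → Forest A → Tree A
    big a l l′ = node a (l ++ l′)

    big-sizeˡ : ∀ a l l′ → size l <ℕ sizeᵗ (big a l l′)
    big-sizeˡ a l l′ rewrite size-++ l l′ = s≤s (m≤m+n (size l) (size l′))

    big-sizeʳ : ∀ a l l′ → size l′ <ℕ sizeᵗ (big a l l′)
    big-sizeʳ a l l′ rewrite size-++ l l′ = s≤s (m≤n+m (size l′) (size l))

    big-size : ∀ a l l′ → sizeᵗ (big a l l′) ≤ℕ size (big a l l′ ∷ [])
    big-size a l l′ = m≤m+n _ 0

    hole-hole : A → ∀ l r l′ r′ → (∀ s → fill (hole l r) s ≡ fill (hole l′ r′) s) →
                hole l r ≡ hole l′ r′
    hole-hole a l r l′ r′ eq
      with refl , _ , refl ← split l l′ (eq (big a l l′ ∷ []))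
                               (big-sizeˡ a l l′) (big-sizeʳ a l l′) = refl

    hole≢nest : ∀ l r l′ a p r′ → ¬ (∀ s → fill (hole l r) s ≡ fill (nest l′ a p r′) s)
    hole≢nest l r l′ a p r′ eq = m+1+n≢m (length l +ℕ length r) {0} (begin
      (length l +ℕ length r) +ℕ 1                  ≡⟨ +-comm _ 1 ⟩
      suc (length l +ℕ length r)                   ≡⟨ +-suc (length l) (length r) ⟨
      length l +ℕ suc (length r)                   ≡⟨ length-++ l ⟨
      length (l ++ t ∷ r)                          ≡⟨ cong length (eq (t ∷ [])) ⟩
      length (l′ ++ node a (fill p (t ∷ [])) ∷ r′) ≡⟨ length-++ l′ ⟩
      length l′ +ℕ suc (length r′)                 ≡⟨ length-++ l′ ⟨
      length (l′ ++ node a (fill p []) ∷ r′)       ≡⟨ cong length (eq []) ⟨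
      length (l ++ r)                              ≡⟨ length-++ l ⟩
      length l +ℕ length r                         ∎)
      where t = node a []

  fill-faithful : ∀ {p q} → (∀ s → fill p s ≡ fill q s) → p ≡ q
  fill-faithful {hole [] r} {hole [] r′} eq = cong (hole []) (eq [])
  fill-faithful {hole [] r} {hole l′@(node a _ ∷ _) r′} eq = hole-hole a [] r l′ r′ eq
  fill-faithful {hole l@(node a _ ∷ _) r} {hole l′ r′} eq = hole-hole a l r l′ r′ eq
  fill-faithful {hole l r} {nest l′ a p r′} eq = ⊥-elim (hole≢nest l r l′ a p r′ eq)
  fill-faithful {nest l a p r} {hole l′ r′} eq =
    ⊥-elim (hole≢nest l′ r′ l a p r (λ s → sym (eq s)))
  fill-faithful {nest l a p r} {nest l′ a′ p′ r′} eq
    with refl , e , refl ← split l l′ (eq (big a l l′ ∷ []))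
           (<-≤-trans (big-sizeˡ a l l′)
             (≤-trans (big-size a l l′) (≤-trans (size-fill p′ _) (m≤n+m _ 1))))
           (<-≤-trans (big-sizeʳ a l l′)
             (≤-trans (big-size a l l′) (≤-trans (size-fill p _) (m≤n+m _ 1))))
    with refl , _ ← node-injective e =
    cong (λ z → nest l a z r) (fill-faithful λ s →
      proj₂ (node-injective (proj₁ (∷-injective (++-cancelˡ l _ _ (eq s))))))

infix 10 _^Δ
_^Δ : Set → ForestAlgebra
A ^Δ = record
  { H          = Forest A
  ; _+_        = _++_
  ; 0#         = []
  ; +-isMonoid = ++-isMonoid
  ; V-monoid   = record { isMonoid = ⊙-isMonoid }
  ; _·_        = fill
  ; ·-cong     = λ { refl h → refl }
  ; ·-identity = ++-identityʳ
  ; ·-assoc    = fill-⊙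
  ; faithful   = fill-faithful
  ; [_+□]      = λ s → hole s []
  ; [□+_]      = λ s → hole [] s
  ; +□-act     = λ s t → cong (s ++_) (++-identityʳ t)
  ; □+-act     = λ s t → refl
  }

-- The context a□.
letter : ∀ {A} → A → Context A
letter a = nest [] a (hole [] []) []

module Extension {A : Set} (F : ForestAlgebra) (φ : A → ForestAlgebra.V F) where
  open ForestAlgebra F

  evalᶠ : Forest A → H
  evalᶠ []             = 0#
  evalᶠ (node a s ∷ t) = φ a · evalᶠ s + evalᶠ t

  evalᶜ : Context A → V
  evalᶜ (hole l r)     = [ evalᶠ l +□] ∙ [□+ evalᶠ r ]
  evalᶜ (nest l a p r) = ([ evalᶠ l +□] ∙ [□+ evalᶠ r ]) ∙ (φ a ∙ evalᶜ p)

  private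
    module V = Monoid V-monoid

  evalᶠ-++ : ∀ s t → evalᶠ (s ++ t) ≡ evalᶠ s + evalᶠ t
  evalᶠ-++ []             t = sym (+-identityˡ _)
  evalᶠ-++ (node a s ∷ u) t =
    trans (cong (φ a · evalᶠ s +_) (evalᶠ-++ u t)) (sym (+-assoc _ _ _))

  around : ∀ x y h → ([ x +□] ∙ [□+ y ]) · h ≡ x + (h + y)
  around x y h = trans (·-assoc _ _ h) (trans (+□-act x _) (cong (x +_) (□+-act y h)))

  around-nest : ∀ l a p r h →
                evalᶜ (nest l a p r) · h ≡ evalᶠ l + (φ a · evalᶜ p · h + evalᶠ r)
  around-nest l a p r h = trans (·-assoc _ _ h)
    (trans (around _ _ _) (cong (λ z → evalᶠ l + (z + evalᶠ r)) (·-assoc _ _ h)))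

  evalᶜ-fill : ∀ p s → evalᶠ (fill p s) ≡ evalᶜ p · evalᶠ s
  evalᶜ-fill (hole l r) s = trans (evalᶠ-++ l (s ++ r))
    (trans (cong (evalᶠ l +_) (evalᶠ-++ s r)) (sym (around _ _ _)))
  evalᶜ-fill (nest l a p r) s = trans (evalᶠ-++ l _)
    (trans (cong (λ z → evalᶠ l + (φ a · z + evalᶠ r)) (evalᶜ-fill p s))
           (sym (around-nest l a p r _)))

  +-regroup : ∀ l l′ x r′ r → (l + l′) + (x + (r′ + r)) ≡ l + ((l′ + (x + r′)) + r)
  +-regroup l l′ x r′ r = begin
    (l + l′) + (x + (r′ + r))   ≡⟨ +-assoc l l′ _ ⟩
    l + (l′ + (x + (r′ + r)))   ≡⟨ cong (λ z → l + (l′ + z)) (+-assoc x r′ r) ⟨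
    l + (l′ + ((x + r′) + r))   ≡⟨ cong (l +_) (+-assoc l′ (x + r′) r) ⟨
    l + ((l′ + (x + r′)) + r)   ∎

  evalᶜ-surround : ∀ l p r h →
                   evalᶜ (surround l p r) · h ≡ evalᶠ l + (evalᶜ p · h + evalᶠ r)
  evalᶜ-surround l (hole l′ r′) r h = begin
    ([ evalᶠ (l ++ l′) +□] ∙ [□+ evalᶠ (r′ ++ r) ]) · h
      ≡⟨ around _ _ h ⟩
    evalᶠ (l ++ l′) + (h + evalᶠ (r′ ++ r))
      ≡⟨ cong₂ (λ x y → x + (h + y)) (evalᶠ-++ l l′) (evalᶠ-++ r′ r) ⟩
    (evalᶠ l + evalᶠ l′) + (h + (evalᶠ r′ + evalᶠ r))
      ≡⟨ +-regroup _ _ _ _ _ ⟩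
    evalᶠ l + ((evalᶠ l′ + (h + evalᶠ r′)) + evalᶠ r)
      ≡⟨ cong (λ z → evalᶠ l + (z + evalᶠ r)) (around _ _ h) ⟨
    evalᶠ l + (evalᶜ (hole l′ r′) · h + evalᶠ r) ∎
  evalᶜ-surround l (nest l′ a p r′) r h = begin
    evalᶜ (nest (l ++ l′) a p (r′ ++ r)) · h
      ≡⟨ around-nest (l ++ l′) a p (r′ ++ r) h ⟩
    evalᶠ (l ++ l′) + (k + evalᶠ (r′ ++ r))
      ≡⟨ cong₂ (λ x y → x + (k + y)) (evalᶠ-++ l l′) (evalᶠ-++ r′ r) ⟩
    (evalᶠ l + evalᶠ l′) + (k + (evalᶠ r′ + evalᶠ r))
      ≡⟨ +-regroup _ _ _ _ _ ⟩
    evalᶠ l + ((evalᶠ l′ + (k + evalᶠ r′)) + evalᶠ r)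
      ≡⟨ cong (λ z → evalᶠ l + (z + evalᶠ r)) (around-nest l′ a p r′ h) ⟨
    evalᶠ l + (evalᶜ (nest l′ a p r′) · h + evalᶠ r) ∎
    where k = φ a · evalᶜ p · h

  evalᶜ-⊙ : ∀ p q h → evalᶜ (p ⊙ q) · h ≡ evalᶜ p · evalᶜ q · h
  evalᶜ-⊙ (hole l r)     q h = trans (evalᶜ-surround l q r h) (sym (around _ _ _))
  evalᶜ-⊙ (nest l a p r) q h = trans (around-nest l a (p ⊙ q) r h)
    (trans (cong (λ z → evalᶠ l + (φ a · z + evalᶠ r)) (evalᶜ-⊙ p q h))
           (sym (around-nest l a p r _)))

  -- The unique homomorphism that maps each a□ to φ a.
  extend : Hom (A ^Δ) F
  extend = record
    { onH = evalᶠ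
    ; onV = evalᶜ
    ; onH-homo = record
      { isMagmaHomomorphism = record
        { isRelHomomorphism = record { cong = cong evalᶠ } ; homo = evalᶠ-++ }
      ; ε-homo = refl
      }
    ; onV-homo = record
      { isMagmaHomomorphism = record
        { isRelHomomorphism = record { cong = V.reflexive ∘ cong evalᶜ }
        ; homo = λ p q → faithful λ h → trans (evalᶜ-⊙ p q h) (sym (·-assoc _ _ h))
        }
      ; ε-homo = faithful λ h → trans (around _ _ h)
          (trans (+-identityˡ _) (trans (+-identityʳ h) (sym (·-identity h))))
      }
    ; ·-homo = evalᶜ-fill
    ; +□-homo = λ s → faithful λ h → trans (around _ _ h)
        (trans (cong (evalᶠ s +_) (+-identityʳ h)) (sym (+□-act _ h)))
    ; □+-homo = λ s → faithful λ h → trans (around _ _ h)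
        (trans (+-identityˡ _) (sym (□+-act _ h)))
    }

open Extension public using (extend)

infixl 5 _∘ʷ_
_∘ʷ_ : ForestAlgebra → ForestAlgebra → ForestAlgebra
F₁ ∘ʷ F₂ = record
  { H          = F₁.H × F₂.H
  ; _+_        = λ (h₁ , h₂) (g₁ , g₂) → h₁ F₁.+ g₁ , h₂ F₂.+ g₂
  ; 0#         = F₁.0# , F₂.0#
  ; +-isMonoid = record
    { isSemigroup = record
      { isMagma = record { isEquivalence = isEquivalence ; ∙-cong = cong₂ _ }
      ; assoc = λ _ _ _ → cong₂ _,_ (F₁.+-assoc _ _ _) (F₂.+-assoc _ _ _)
      }
    ; identity = (λ _ → cong₂ _,_ (F₁.+-identityˡ _) (F₂.+-identityˡ _))
               , (λ _ → cong₂ _,_ (F₁.+-identityʳ _) (F₂.+-identityʳ _))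
    }
  ; V-monoid   = record
    { Carrier = F₁.V × (F₁.H → F₂.V)
    ; _≈_ = λ (v , f) (w , g) → v F₁.≈ w × (∀ h → f h F₂.≈ g h)
    ; _∙_ = λ (v , f) (w , g) → v F₁.∙ w , λ h → f (w F₁.· h) F₂.∙ g h
    ; ε = F₁.1# , λ _ → F₂.1#
    ; isMonoid = record
      { isSemigroup = record
        { isMagma = record
          { isEquivalence = record
            { refl  = V₁.refl , λ _ → V₂.refl
            ; sym   = λ (p , q) → V₁.sym p , λ h → V₂.sym (q h)
            ; trans = λ (p , q) (p′ , q′) → V₁.trans p p′ , λ h → V₂.trans (q h) (q′ h)
            }
          ; ∙-cong = λ { {_ , f} {_ , g} {w , _} {w′ , _} (p , q) (p′ , q′) →
              V₁.∙-cong p p′ , λ h → V₂.∙-cong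
                (V₂.trans (q (w F₁.· h)) (V₂.reflexive (cong g (F₁.·-cong p′ h)))) (q′ h) }
          }
        ; assoc = λ { (_ , f) (v , _) (w , _) → V₁.assoc _ _ _ , λ h → V₂.trans
            (V₂.assoc _ _ _)
            (V₂.∙-congʳ (V₂.reflexive (cong f (sym (F₁.·-assoc v w h))))) }
        }
      ; identity = (λ _ → V₁.identityˡ _ , λ _ → V₂.identityˡ _)
                 , (λ { (_ , f) → V₁.identityʳ _ , λ h →
                      V₂.trans (V₂.identityʳ _) (V₂.reflexive (cong f (F₁.·-identity h))) })
      }
    }
  ; _·_        = λ (v , f) (h₁ , h₂) → v F₁.· h₁ , f h₁ F₂.· h₂
  ; ·-cong     = λ (p , q) (h₁ , h₂) → cong₂ _,_ (F₁.·-cong p h₁) (F₂.·-cong (q h₁) h₂)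
  ; ·-identity = λ (h₁ , h₂) → cong₂ _,_ (F₁.·-identity h₁) (F₂.·-identity h₂)
  ; ·-assoc    = λ _ _ (h₁ , h₂) → cong₂ _,_ (F₁.·-assoc _ _ h₁) (F₂.·-assoc _ _ h₂)
  ; faithful   = λ eq → F₁.faithful (λ h → cong proj₁ (eq (h , F₂.0#)))
                      , λ h → F₂.faithful (λ h₂ → cong proj₂ (eq (h , h₂)))
  ; [_+□]      = λ (h₁ , h₂) → F₁.[ h₁ +□] , λ _ → F₂.[ h₂ +□]
  ; [□+_]      = λ (h₁ , h₂) → F₁.[□+ h₁ ] , λ _ → F₂.[□+ h₂ ]
  ; +□-act     = λ _ _ → cong₂ _,_ (F₁.+□-act _ _) (F₂.+□-act _ _)
  ; □+-act     = λ _ _ → cong₂ _,_ (F₁.□+-act _ _) (F₂.□+-act _ _)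
  }
  where
  module F₁ = ForestAlgebra F₁
  module F₂ = ForestAlgebra F₂
  module V₁ = Monoid F₁.V-monoid
  module V₂ = Monoid F₂.V-monoid

module _ {A : Set} {F₁ F₂ : ForestAlgebra} where

  infixl 5 _⊗_
  _⊗_ : Hom (A ^Δ) F₁ → Hom ((A × ForestAlgebra.H F₁) ^Δ) F₂ → Hom (A ^Δ) (F₁ ∘ʷ F₂)
  α ⊗ β = extend (F₁ ∘ʷ F₂) λ a → onV α (letter a) , λ h → onV β (letter (a , h))

-- Horizontally false is 0 and true is ∞; vertically true is 1 and false is 0.
𝒰₁ : ForestAlgebra
𝒰₁ = record
  { H          = Bool
  ; _+_        = _∨_
  ; 0#         = false
  ; +-isMonoid = ∨-isMonoid
  ; V-monoid   = record { isMonoid = ∧-isMonoid }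
  ; _·_        = λ { true h → h ; false _ → true }
  ; ·-cong     = λ { refl _ → refl }
  ; ·-identity = λ _ → refl
  ; ·-assoc    = λ { true _ _ → refl ; false _ _ → refl }
  ; faithful   = λ { {true} {true} _ → refl ; {false} {false} _ → refl
                   ; {true} {false} eq → sym (eq false) ; {false} {true} eq → sym (eq false) }
  ; [_+□]      = not
  ; [□+_]      = not
  ; +□-act     = λ { true _ → refl ; false _ → refl }
  ; □+-act     = λ { true h → sym (∨-zeroʳ h) ; false h → sym (∨-identityʳ h) }
  }

rootLabels : ∀ {A} → Forest A → List A
rootLabels = map label

OneDefinite : ∀ {B F} → Hom (B ^Δ) F → Set
OneDefinite {B} β = ∀ s s′ → SetEq (setoid B) (rootLabels s) (rootLabels s′) → onH β s ≡ onH β s′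

data Basic {B : Set} : {F : ForestAlgebra} → Hom (B ^Δ) F → Set₁ where
  into-𝒰₁     : (β : Hom (B ^Δ) 𝒰₁) → Basic β
  oneDefinite : ∀ {F} → IsFinite F → (β : Hom (B ^Δ) F) → OneDefinite β → Basic β

-- The products β₁ ⊗ ⋯ ⊗ βₖ (k ≥ 1), associated to the left, with all βᵢ basic.
data BasicProduct {A : Set} : {F : ForestAlgebra} → Hom (A ^Δ) F → Set₁ where
  single : ∀ {F} {β : Hom (A ^Δ) F} → Basic β → BasicProduct β
  _▷_    : ∀ {F G} {γ : Hom (A ^Δ) F} {β : Hom ((A × ForestAlgebra.H F) ^Δ) G} →
           BasicProduct γ → Basic β → BasicProduct (γ ⊗ β)

_FactorsThrough_ : ∀ {A F G} → Hom (A ^Δ) G → Hom (A ^Δ) F → Set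
β FactorsThrough α = ∀ s s′ → onH α s ≡ onH α s′ → onH β s ≡ onH β s′

EFEXHomomorphism : ∀ {A F} → Hom (A ^Δ) F → Set₁
EFEXHomomorphism {A} α =
  Σ ForestAlgebra λ G → Σ (Hom (A ^Δ) G) λ γ → BasicProduct γ × α FactorsThrough γ

module Reachability (F : ForestAlgebra) where
  open ForestAlgebra F

  infix 4 _≤_ _≅_ _>[_]

  _≤_ : H → H → Set
  h ≤ h′ = ∃ λ v → h ≡ v · h′

  _≅_ : H → H → Set
  h ≅ h′ = h ≤ h′ × h′ ≤ h

  -- Reachability classes are given by representatives: h ≅ g says that h lies
  -- in the class Γ of g, and h >[ g ] that the class of h is strictly above Γ.
  _>[_] : H → H → Set
  h >[ g ] = g ≤ h × ¬ (h ≅ g)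

  ≤-refl : ∀ {h} → h ≤ h
  ≤-refl = 1# , sym (·-identity _)

  ≤-transitive : ∀ {h h′ h″} → h ≤ h′ → h′ ≤ h″ → h ≤ h″
  ≤-transitive (v , refl) (w , refl) = v ∙ w , sym (·-assoc v w _)

  >-upward : ∀ {h h′ g} → h ≤ h′ → h >[ g ] → h′ >[ g ]
  >-upward h≤h′ (g≤h , h≇g) =
    ≤-transitive g≤h h≤h′ , λ (h′≤g , _) → h≇g (≤-transitive h≤h′ h′≤g , g≤h)

  module _ (fin : IsFinite F) where
    open IsFinite fin

    _≟_ : DecidableEquality H
    h ≟ h′ = map′ (λ eq → trans (sym (I.strictlyInverseʳ h))
                            (trans (cong I.from eq) (I.strictlyInverseʳ h′)))
                  (cong I.to) (I.to h ≟ᶠ I.to h′)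
      where module I = Inverse (proj₂ H-finite)

    _≤?_ : Decidable _≤_
    h ≤? h′ = map′ (λ (i , eq) → I.from i , eq)
                   (λ (v , eq) → I.to v , trans eq (sym (·-cong (I.strictlyInverseʳ v) h′)))
                   (any? λ i → h ≟ (I.from i · h′))
      where module I = Inverse (proj₂ V-finite)

    _>?[_] : Decidable _>[_]
    h >?[ g ] = (g ≤? h) ×-dec ¬? ((h ≤? g) ×-dec (g ≤? h))

-- The quotient of a forest algebra that identifies all elements of
-- I_Γ = { h : h ≯ Γ } with ∞, where Γ is the class of g.
module ClassQuotient (F : ForestAlgebra) (g : ForestAlgebra.H F)
                     (above? : ∀ h → Dec (Reachability._>[_] F h g)) where
  open ForestAlgebra F
  open Reachability F

  data H/Γ : Set where
    ∞     : H/Γ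
    above : (h : H) → .(h >[ g ]) → H/Γ

  class : (h : H) → Dec (h >[ g ]) → H/Γ
  class h (yes p) = above h p
  class h (no  _) = ∞

  [_] : H → H/Γ
  [ h ] = class h (above? h)

  -- A representative; g itself lies in I_Γ.
  rep : H/Γ → H
  rep ∞           = g
  rep (above h _) = h

  _+Γ_ : H/Γ → H/Γ → H/Γ
  x +Γ y = [ rep x + rep y ]

  _·Γ_ : V → H/Γ → H/Γ
  v ·Γ x = [ v · rep x ]

  []-∞ : ∀ {h} → ¬ (h >[ g ]) → [ h ] ≡ ∞
  []-∞ {h} h≯g with above? h
  ... | yes p = ⊥-elim (h≯g p)
  ... | no  _ = refl

  recompute> : ∀ {h} → .(h >[ g ]) → h >[ g ]
  recompute> {h} p = recompute (above? h) p

  []-above : ∀ {h} .(p : h >[ g ]) → [ h ] ≡ above h p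
  []-above {h} p with above? h
  ... | yes _ = refl
  ... | no ¬q = ⊥-elim (¬q (recompute> p))

  g≯g : ¬ (g >[ g ])
  g≯g (_ , g≇g) = g≇g (≤-refl , ≤-refl)

  [rep] : ∀ x → [ rep x ] ≡ x
  [rep] ∞           = []-∞ g≯g
  [rep] (above h p) = []-above p

  act-rep : ∀ v h → [ v · rep [ h ] ] ≡ [ v · h ]
  act-rep v h with above? h
  ... | yes _  = refl
  ... | no h≯g = trans ([]-∞ (g≯g ∘ >-upward (v , refl)))
                       (sym ([]-∞ (h≯g ∘ >-upward (v , refl))))

  +-repˡ : ∀ h k → [ rep [ h ] + k ] ≡ [ h + k ]
  +-repˡ h k = trans (cong [_] (sym (□+-act k (rep [ h ]))))
                     (trans (act-rep [□+ k ] h) (cong [_] (□+-act k h)))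

  +-repʳ : ∀ k h → [ k + rep [ h ] ] ≡ [ k + h ]
  +-repʳ k h = trans (cong [_] (sym (+□-act k (rep [ h ]))))
                     (trans (act-rep [ k +□] h) (cong [_] (+□-act k h)))

  +Γ-isMonoid : IsMonoid _≡_ _+Γ_ [ 0# ]
  +Γ-isMonoid = record
    { isSemigroup = record
      { isMagma = record { isEquivalence = isEquivalence ; ∙-cong = cong₂ _+Γ_ }
      ; assoc = λ x y z → trans (+-repˡ (rep x + rep y) (rep z))
          (trans (cong [_] (+-assoc (rep x) (rep y) (rep z)))
                 (sym (+-repʳ (rep x) (rep y + rep z))))
      }
    ; identity = (λ x → trans (+-repˡ 0# (rep x)) (trans (cong [_] (+-identityˡ (rep x))) ([rep] x)))
               , (λ x → trans (+-repʳ (rep x) 0#) (trans (cong [_] (+-identityʳ (rep x))) ([rep] x)))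
    }

  ·Γ-assoc : ∀ v w x → (v ∙ w) ·Γ x ≡ v ·Γ (w ·Γ x)
  ·Γ-assoc v w x = trans (cong [_] (·-assoc v w (rep x))) (sym (act-rep v (w · rep x)))

  infix 4 _≈Γ_
  _≈Γ_ : V → V → Set
  v ≈Γ w = ∀ x → v ·Γ x ≡ w ·Γ x

  ≈⇒≈Γ : ∀ {v w} → v ≈ w → v ≈Γ w
  ≈⇒≈Γ p x = cong [_] (·-cong p (rep x))

  ∙-isMonoidΓ : IsMonoid _≈Γ_ _∙_ 1#
  ∙-isMonoidΓ = record
    { isSemigroup = record
      { isMagma = record
        { isEquivalence = record
          { refl  = λ _ → refl
          ; sym   = λ p x → sym (p x)
          ; trans = λ p q x → trans (p x) (q x)
          }
        ; ∙-cong = λ {v} {v′} {w} {w′} p q x → trans (·Γ-assoc v w x)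
            (trans (cong (v ·Γ_) (q x)) (trans (p (w′ ·Γ x)) (sym (·Γ-assoc v′ w′ x))))
        }
      ; assoc = λ u v w → ≈⇒≈Γ (VM.assoc u v w)
      }
    ; identity = (λ v → ≈⇒≈Γ (VM.identityˡ v)) , (λ v → ≈⇒≈Γ (VM.identityʳ v))
    }
    where module VM = Monoid V-monoid

  quotient : ForestAlgebra
  quotient = record
    { H          = H/Γ
    ; _+_        = _+Γ_
    ; 0#         = [ 0# ]
    ; +-isMonoid = +Γ-isMonoid
    ; V-monoid   = record { isMonoid = ∙-isMonoidΓ }
    ; _·_        = _·Γ_
    ; ·-cong     = λ p → p
    ; ·-identity = λ x → trans (cong [_] (·-identity (rep x))) ([rep] x)
    ; ·-assoc    = ·Γ-assoc
    ; faithful   = λ p → p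
    ; [_+□]      = λ x → [ rep x +□]
    ; [□+_]      = λ x → [□+ rep x ]
    ; +□-act     = λ x y → cong [_] (+□-act (rep x) (rep y))
    ; □+-act     = λ x y → cong [_] (□+-act (rep x) (rep y))
    }

  projection : Hom F quotient
  projection = record
    { onH = [_]
    ; onV = id
    ; onH-homo = record
      { isMagmaHomomorphism = record
        { isRelHomomorphism = record { cong = cong [_] }
        ; homo = λ h k → sym (trans (+-repˡ h (rep [ k ])) (+-repʳ h k))
        }
      ; ε-homo = refl
      }
    ; onV-homo = record
      { isMagmaHomomorphism = record
        { isRelHomomorphism = record { cong = ≈⇒≈Γ }
        ; homo = λ _ _ _ → refl
        }
      ; ε-homo = λ _ → refl
      }
    ; ·-homo = λ v h → sym (act-rep v h)
    ; +□-homo = λ h x → trans (cong [_] (+□-act h (rep x)))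
        (trans (sym (+-repˡ h (rep x))) (cong [_] (sym (+□-act (rep [ h ]) (rep x)))))
    ; □+-homo = λ h x → trans (cong [_] (□+-act h (rep x)))
        (trans (sym (+-repʳ (rep x) h)) (cong [_] (sym (□+-act (rep [ h ]) (rep x)))))
    }

module _ {B : Set} where

  branches : Forest B → List (B × Forest B)
  branches = map λ t → label t , children t

  -- T^{k+1}_s is branches s, read as a set of elements of B × (H_B / ∼ₖ).
  infix 4 _∼[_]_
  _∼[_]_ : Forest B → ℕ → Forest B → Set
  ∼-isEquivalence : ∀ k → IsEquivalence (_∼[ k ]_)

  ∼-setoid : ℕ → Setoid 0ℓ 0ℓ
  ∼-setoid k = record { isEquivalence = ∼-isEquivalence k }

  s ∼[ zero  ] s′ = ⊤
  s ∼[ suc k ] s′ = SetEq (×-setoid (setoid B) (∼-setoid k)) (branches s) (branches s′)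

  ∼-isEquivalence zero    = record { refl = _ ; sym = _ ; trans = _ }
  ∼-isEquivalence (suc k) = record
    { refl  = (λ m → m) , (λ m → m)
    ; sym   = λ (p , q) → q , p
    ; trans = λ (p , q) (p′ , q′) → (λ m → p′ (p m)) , (λ m → q (q′ m))
    }

module _ {A : Set} {F : ForestAlgebra} where

  -- s ^^ α is s^α.
  infixl 8 _^^_
  _^^_ : Forest A → Hom (A ^Δ) F → Forest (A × ForestAlgebra.H F)
  []             ^^ α = []
  (node a t ∷ s) ^^ α = node (a , onH α t) (t ^^ α) ∷ s ^^ α

module AtClass {F : ForestAlgebra} (fin : IsFinite F) (g : ForestAlgebra.H F) =
  ClassQuotient F g (λ h → Reachability._>?[_] F fin h g)

module _ {A : Set} {F : ForestAlgebra} (fin : IsFinite F) (α : Hom (A ^Δ) F) where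
  open ForestAlgebra F using (H)
  open Reachability F using (_≅_)

  -- α_Γ for Γ the class of g.
  quotientAt : (g : H) → Hom (A ^Δ) (AtClass.quotient fin g)
  quotientAt g = _∘ʰ_ {A ^Δ} {F} {AtClass.quotient fin g} (AtClass.projection fin g) α

  infix 4 _≡[_,_]_

  -- s₁ ≡_{α,k,Γ} s₂ for Γ the class of g.
  _≡[_,_]_ : Forest A → ℕ → H → Forest A → Set
  s₁ ≡[ k , g ] s₂ =
    (s₁ ^^ quotientAt g) ∼[ k ] (s₂ ^^ quotientAt g) × onH α s₁ ≅ g × onH α s₂ ≅ g

  Nonconfusing : Set
  Nonconfusing = ∃ λ k → (0 <ℕ k) ×
    (∀ g s₁ s₂ → s₁ ≡[ k , g ] s₂ → onH α s₁ ≡ onH α s₂)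

{-# OPTIONS --safe #-}
-- A product of basic homomorphisms is nonconfusing: the truth value of a 𝒰₁-factor is
-- constant on a reachability class, and a 1-definite factor reads one more level.
-- If α factors through a nonconfusing γ and s, s′ are similar to depth k for a class
-- Γ of α, choose a minimal γ-class among those over Γ and replace the subforests at
-- depth k by forests of equal α-value in it.  The results are similar for γ, so γ and
-- hence α identify them.
--
-- Conversely, whether α(s) = g is computed by induction on the class Γ of g, from the
-- top.  Call the (k+1)-type of s^{α_Γ} good if it belongs to a forest with value above
-- or in Γ.  If α is nonconfusing with parameter k and all types occurring in s are
-- good, then α(s) is determined by the type of s; types need only 1-definite layers,
-- and the occurrence of a type that is not good is detected by a 𝒰₁-layer.
module Submission where

open import Defs
open import Algebra.Definitions using (Commutative; Idempotent)
open import Algebra.Morphism.Structures using (module MonoidMorphisms)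
open import Data.Bool.Base using (Bool; true; false; not; _∨_; _∧_)
open import Data.Bool.Properties using (not-injective; ∨-comm; ∨-conicalʳ; ∨-conicalˡ; ∨-idem; ∨-identityʳ; ∨-isMonoid; ∨-zeroʳ)
open import Data.Fin.Base using (Fin; zero; suc; combine; finToFun; funToFin)
open import Data.Fin.Induction using (spo-wellFounded)
open import Data.Fin.Properties using (*↔×; 2↔Bool; combine-injective; finToFun-funToFin)
open import Data.List.Base using (List; []; _∷_; _++_; allFin; cartesianProduct; cartesianProductWith; filter; length; map)
open import Data.List.Membership.Propositional using (_∈_; find; lose)
open import Data.List.Membership.Propositional.Properties using (∈-++⁻; ∈-++⁺ʳ; ∈-++⁺ˡ; ∈-allFin; ∈-cartesianProduct⁺; ∈-cartesianProductWith⁺; ∈-filter⁺; ∈-map⁻; ∈-map⁺)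
open import Data.List.Properties using (++-identityʳ; filter-notAll; map-++)
open import Data.List.Relation.Unary.All using (All)
open import Data.List.Relation.Unary.All.Properties using (¬All⇒Any¬)
open import Data.List.Relation.Unary.Any using (Any; here; there)
open import Data.Maybe.Base using (Maybe; just; nothing; fromMaybe)
open import Data.Maybe.Properties using (<∣>-monoid)
open import Data.Nat.Base using (ℕ; zero; suc; _*_; _<_; _^_; s≤s; z≤n)
open import Data.Nat.Induction using (<-wellFounded)
open import Data.Product.Base using (∃; _×_; _,_; proj₁; proj₂)
open import Data.Product.Function.NonDependent.Propositional using (_×-↔_)
open import Data.Product.Relation.Binary.Pointwise.NonDependent using (×-setoid)
open import Data.Sum.Base using (_⊎_; inj₁; inj₂; [_,_]′)
open import Data.Unit.Base using (⊤)
open import Function.Base using (_∘_; _on_; flip; id)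
open import Function.Bundles using (_⇔_; Injection; Inverse; mk⇔; mk↔ₛ′)
open import Function.Construct.Composition using (_↔-∘_)
open import Function.Construct.Symmetry using (↔-sym)
open import Function.Properties.Inverse using (Inverse⇒Injection)
open import Induction.WellFounded using (Acc; WellFounded; acc; module Subrelation)
open import Level using (0ℓ)
open import Relation.Binary.Bundles using (Setoid)
open import Relation.Binary.Core using (Rel)
open import Relation.Binary.Definitions using (DecidableEquality; Transitive)
open import Relation.Binary.PropositionalEquality using (_≡_; cong; cong₂; isEquivalence; refl; resp₂; setoid; subst; subst₂; sym; trans)
open import Relation.Binary.Structures using (IsEquivalence)
open import Relation.Nullary.Decidable using (Dec; yes; no; _×-dec_; dec-false; dec-true; decidable-stable; does; map′; via-injection; ¬?)
open import Relation.Nullary.Negation using (contradiction; ¬_)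

import Data.Fin.Properties as Fin
import Data.List.Relation.Binary.Subset.Setoid as SetoidSubset
import Data.List.Relation.Unary.All as All
import Data.List.Relation.Unary.Any as Any
import Data.List.Relation.Unary.Any.Properties as AnyProperties
import Relation.Binary.Construct.On as On

open ForestAlgebra using (H)

-- Finite types

Finite-× : {X Y : Set} → Finite (setoid X) → Finite (setoid Y) → Finite (setoid (X × Y))
Finite-× (_ , i) (_ , j) = _ , ↔-sym *↔× ↔-∘ (i ×-↔ j)

-- The order is transported along the bijection to `Fin n`, where every strict partial order is
-- well-founded.
Finite⇒wellFounded : {X : Set} {_⊏_ : Rel X 0ℓ} → Finite (setoid X) →
                     (∀ {x} → ¬ (x ⊏ x)) → Transitive _⊏_ → WellFounded _⊏_
Finite⇒wellFounded {X} {_⊏_} (n , i) irr tr =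
  Subrelation.wellFounded {_<₂_ = (_⊏_ on I.from) on I.to}
    (subst₂ _⊏_ (sym (I.strictlyInverseʳ _)) (sym (I.strictlyInverseʳ _)))
    (On.wellFounded I.to (spo-wellFounded record
      { isEquivalence = isEquivalence
      ; irrefl        = λ { refl → irr }
      ; trans         = tr
      ; <-resp-≈      = resp₂ (_⊏_ on I.from)
      }))
  where module I = Inverse i

Finite⇒≟ : {X : Set} → Finite (setoid X) → DecidableEquality X
Finite⇒≟ (_ , i) = via-injection (Inverse⇒Injection i) Fin._≟_

enumerate : {X : Set} → Finite (setoid X) → List X
enumerate (n , i) = map (Inverse.from i) (allFin n)

∈-enumerate : {X : Set} (fin : Finite (setoid X)) (x : X) → x ∈ enumerate fin
∈-enumerate (n , i) x =
  subst (_∈ _) (Inverse.strictlyInverseʳ i x) (∈-map⁺ (Inverse.from i) (∈-allFin (Inverse.to i x)))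

-- Bisimilarity up to depth k

module _ {A : Set} where

  -- One half of a back-and-forth condition. As a record it lets `R`, `s` and `s′` be inferred from
  -- its type.
  record Matched (R : Forest A → Forest A → Set) (s s′ : Forest A) : Set where
    constructor matched
    field
      match : ∀ {x} → x ∈ s → ∃ λ y → y ∈ s′ × label x ≡ label y × R (children x) (children y)

  open Matched public

  Matched-map : ∀ {R S : Forest A → Forest A → Set} {s s′} →
                (∀ {t t′} → R t t′ → S t t′) → Matched R s s′ → Matched S s s′
  Matched-map f m = matched λ x∈s → let y , y∈s′ , e , r = match m x∈s in y , y∈s′ , e , f r

  -- For `L = EqualOn γ` this is `∼[ k ]` on forests relabelled by γ. An arbitrary `L` allows
  -- coarser comparisons of labels, and `flip` preserves its orientation, so that `L` need not be
  -- symmetric.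
  Bisim : (Forest A → Forest A → Set) → ℕ → Forest A → Forest A → Set
  Bisim L zero    s s′ = ⊤
  Bisim L (suc k) s s′ = Matched R s s′ × Matched (flip R) s′ s
    where R = λ t t′ → L t t′ × Bisim L k t t′

  Bisim-map : ∀ {L M : Forest A → Forest A → Set} → (∀ {t t′} → L t t′ → M t t′) →
              ∀ k {s s′} → Bisim L k s s′ → Bisim M k s s′
  Bisim-map f zero    b       = _
  Bisim-map f (suc k) (m , n) =
    Matched-map (λ (l , b) → f l , Bisim-map f k b) m ,
    Matched-map (λ (l , b) → f l , Bisim-map f k b) n

  Bisim-pred : ∀ {L : Forest A → Forest A → Set} k {s s′} → Bisim L (suc k) s s′ → Bisim L k s s′
  Bisim-pred zero    b       = _
  Bisim-pred (suc k) (m , n) =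
    Matched-map (λ (l , b) → l , Bisim-pred k b) m ,
    Matched-map (λ (l , b) → l , Bisim-pred k b) n

  Bisim-refl : ∀ {L : Forest A → Forest A → Set} → (∀ {t} → L t t) → ∀ k {s} → Bisim L k s s
  Bisim-refl r zero    = _
  Bisim-refl r (suc k) = matched (λ x∈s → _ , x∈s , refl , r , Bisim-refl r k)
                       , matched (λ x∈s → _ , x∈s , refl , r , Bisim-refl r k)

-- Values of forests, reachability by contexts, and separation

module _ {A : Set} {F : ForestAlgebra} (γ : Hom (A ^Δ) F) where
  open ForestAlgebra F using (_+_; _·_)
  private
    module γ  = Hom γ
    module γH = MonoidMorphisms.IsMonoidHomomorphism γ.onH-homo

  EqualOn : Forest A → Forest A → Set
  EqualOn s t = onH γ s ≡ onH γ t

  onH-++ : ∀ s t → onH γ (s ++ t) ≡ onH γ s + onH γ t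
  onH-++ = γH.homo

  onH-node : ∀ a t s → onH γ (node a t ∷ s) ≡ onV γ (letter a) · onH γ t + onH γ s
  onH-node a t s = trans (onH-++ (node a t ∷ []) s) (cong (_+ onH γ s)
    (trans (cong (λ u → onH γ (node a u ∷ [])) (sym (++-identityʳ t))) (γ.·-homo (letter a) t)))

  ++-congᵒ : ∀ {s s′ t t′} → EqualOn s s′ → EqualOn t t′ → EqualOn (s ++ t) (s′ ++ t′)
  ++-congᵒ e e′ = trans (onH-++ _ _) (trans (cong₂ _+_ e e′) (sym (onH-++ _ _)))

  node-congᵒ : ∀ a {t t′ s s′} → EqualOn t t′ → EqualOn s s′ → EqualOn (node a t ∷ s) (node a t′ ∷ s′)
  node-congᵒ a e e′ = trans (onH-node a _ _)
    (trans (cong₂ (λ x y → onV γ (letter a) · x + y) e e′) (sym (onH-node a _ _)))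

  fill-congᵒ : ∀ p {t t′} → EqualOn t t′ → EqualOn (fill p t) (fill p t′)
  fill-congᵒ p e = trans (γ.·-homo p _) (trans (cong (onV γ p ·_) e) (sym (γ.·-homo p _)))

  -- Asked of the image only: outside it, the algebra of a 1-definite factor is arbitrary.
  record SemilatticeImage : Set where
    field
      comm : ∀ s t → EqualOn (s ++ t) (t ++ s)
      idem : ∀ s → EqualOn (s ++ s) s

  module _ (semi : SemilatticeImage) where
    open SemilatticeImage semi

    ∈-absorb : ∀ {x s} → x ∈ s → EqualOn (x ∷ s) s
    ∈-absorb {x} {_ ∷ s} (here refl) = ++-congᵒ (idem (x ∷ [])) (refl {x = onH γ s})
    ∈-absorb {x} {y ∷ s} (there x∈s) =
      trans (++-congᵒ (comm (x ∷ []) (y ∷ [])) (refl {x = onH γ s}))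
            (++-congᵒ (refl {x = onH γ (y ∷ [])}) (∈-absorb x∈s))

    Matched-absorb : ∀ s {s′} → Matched EqualOn s s′ → EqualOn (s ++ s′) s′
    Matched-absorb []             m = refl
    Matched-absorb (node a t ∷ s) m with node _ t′ , y∈s′ , refl , e ← match m (here refl) =
      trans (node-congᵒ a e (Matched-absorb s (matched (match m ∘ there)))) (∈-absorb y∈s′)

    -- Each tree of one forest has a counterpart of equal value in the other and is absorbed there,
    -- so both forests have the value of `s ++ s′`.
    Matched⇒EqualOn : ∀ {s s′} → Matched EqualOn s s′ → Matched EqualOn s′ s → EqualOn s s′
    Matched⇒EqualOn {s} {s′} m m′ =
      trans (sym (Matched-absorb s′ m′)) (trans (comm s′ s) (Matched-absorb s m))

  infix 4 _≼_
  -- Reachability inside the image of γ: the witness is a context over `A`, which also makes sense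
  -- when γ is not onto.
  _≼_ : Forest A → Forest A → Set
  s ≼ t = ∃ λ p → EqualOn s (fill p t)

  EqualOn⇒≼ : ∀ {s t} → EqualOn s t → s ≼ t
  EqualOn⇒≼ {t = t} e = hole [] [] , trans e (cong (onH γ) (sym (++-identityʳ t)))

  ≼-trans : ∀ {s t u} → s ≼ t → t ≼ u → s ≼ u
  ≼-trans {u = u} (p , e) (q , e′) =
    p ⊙ q , trans e (trans (fill-congᵒ p e′) (cong (onH γ) (sym (fill-⊙ p q u))))

  ∷-≼ : ∀ x s → x ∷ s ≼ s
  ∷-≼ x s = hole (x ∷ []) [] , cong (λ u → onH γ (x ∷ u)) (sym (++-identityʳ s))

  ∈⇒≼ : ∀ {x s} → x ∈ s → s ≼ children x
  ∈⇒≼ {node a t} {_ ∷ s} (here refl) =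
    nest [] a (hole [] []) s , cong (λ u → onH γ (node a u ∷ s)) (sym (++-identityʳ t))
  ∈⇒≼ {x} {y ∷ s} (there x∈s) = ≼-trans (∷-≼ y s) (∈⇒≼ x∈s)

  -- Equality of the labels of t and t′ in γ_Γ, for Γ the class of g and forests
  -- t, t′ already known to lie above or in Γ.
  SameLabel : Forest A → Forest A → Forest A → Set
  SameLabel g t t′ = EqualOn t t′ ⊎ (t ≼ g × t′ ≼ g)

  SameLabel-resp : ∀ {g t t′} → SameLabel g t t′ → t ≼ g → t′ ≼ g
  SameLabel-resp (inj₁ e)       t≼g = ≼-trans (EqualOn⇒≼ (sym e)) t≼g
  SameLabel-resp (inj₂ (_ , q)) _   = q

  SameLabel-sym : ∀ {g t t′} → SameLabel g t t′ → SameLabel g t′ t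
  SameLabel-sym (inj₁ e)       = inj₁ (sym e)
  SameLabel-sym (inj₂ (p , q)) = inj₂ (q , p)

  -- Nonconfusion with parameter `k` for the image of γ. Classes are represented by forests, and
  -- `SameLabel` replaces equality of labels in the quotient.
  Separating : ℕ → Set
  Separating k = ∀ g s s′ → s ≼ g → g ≼ s → s′ ≼ g → g ≼ s′ →
    Bisim (SameLabel g) k s s′ → EqualOn s s′

  -- A forest is reachable from the child forest of each of its trees, so one matched pair of child
  -- forests below `g` puts both `s` and `s′` below `g`. If there is no such pair, all matched
  -- values are equal. The case is read off the witnesses without deciding reachability.
  split-SameLabel : ∀ {g} s {s′} → Matched (SameLabel g) s s′ →
                    Matched EqualOn s s′ ⊎ (s ≼ g × s′ ≼ g)
  split-SameLabel []      m = inj₁ (matched λ ())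
  split-SameLabel (x ∷ s) m with match m (here refl) | split-SameLabel s (matched (match m ∘ there))
  ... | _ | inj₂ (p , q) = inj₂ (≼-trans (∷-≼ x s) p , q)
  ... | y , y∈ , _ , inj₂ (p , q) | _ =
    inj₂ (≼-trans (∈⇒≼ {x} {x ∷ s} (here refl)) p , ≼-trans (∈⇒≼ y∈) q)
  ... | y , y∈ , e , inj₁ e′ | inj₁ m′ =
    inj₁ (matched λ { (here refl) → y , y∈ , e , e′ ; (there x∈s) → match m′ x∈s })

  Matched⇒SameLabel : SemilatticeImage → ∀ {g s s′} → Matched (SameLabel g) s s′ →
                      Matched (flip (SameLabel g)) s′ s → SameLabel g s s′
  Matched⇒SameLabel semi {g} {s} {s′} m n
    with split-SameLabel s m | split-SameLabel s′ (Matched-map SameLabel-sym n)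
  ... | inj₂ pq | _            = inj₂ pq
  ... | inj₁ _  | inj₂ (q , p) = inj₂ (p , q)
  ... | inj₁ m′ | inj₁ n′      = inj₁ (Matched⇒EqualOn semi m′ n′)

-- Products of basic homomorphisms are separating

module _ {A : Set} {F G : ForestAlgebra} (γ : Hom (A ^Δ) F)
         (β : Hom ((A × H F) ^Δ) G) where

  onH-⊗ : ∀ s → onH (γ ⊗ β) s ≡ (onH γ s , onH β (s ^^ γ))
  onH-⊗ [] = sym (cong₂ _,_ (MonoidMorphisms.IsMonoidHomomorphism.ε-homo (Hom.onH-homo γ))
                            (MonoidMorphisms.IsMonoidHomomorphism.ε-homo (Hom.onH-homo β)))
  onH-⊗ (node a t ∷ s) rewrite onH-⊗ t | onH-⊗ s =
    sym (cong₂ _,_ (onH-node γ a t s) (onH-node β (a , onH γ t) (t ^^ γ) (s ^^ γ)))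

  EqualOn-proj₁ : ∀ {s t} → EqualOn (γ ⊗ β) s t → EqualOn γ s t
  EqualOn-proj₁ {s} {t} e = cong proj₁ (trans (sym (onH-⊗ s)) (trans e (onH-⊗ t)))

  EqualOn-⊗ : ∀ {s t} → EqualOn γ s t → EqualOn β (s ^^ γ) (t ^^ γ) → EqualOn (γ ⊗ β) s t
  EqualOn-⊗ e e′ = trans (onH-⊗ _) (trans (cong₂ _,_ e e′) (sym (onH-⊗ _)))

  ≼-proj₁ : ∀ {s t} → _≼_ (γ ⊗ β) s t → _≼_ γ s t
  ≼-proj₁ {s} {t} (p , e) = p , EqualOn-proj₁ {s} {fill p t} e

  SameLabel-proj₁ : ∀ {g s t} → SameLabel (γ ⊗ β) g s t → SameLabel γ g s t
  SameLabel-proj₁ {g} {s} {t} (inj₁ e)       = inj₁ (EqualOn-proj₁ {s} {t} e)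
  SameLabel-proj₁ {g} {s} {t} (inj₂ (p , q)) = inj₂ (≼-proj₁ {s} {g} p , ≼-proj₁ {t} {g} q)

  ^^-++ : ∀ s t → (s ++ t) ^^ γ ≡ (s ^^ γ) ++ (t ^^ γ)
  ^^-++ []             t = refl
  ^^-++ (node a u ∷ s) t = cong (node (a , onH γ u) (u ^^ γ) ∷_) (^^-++ s t)

  SemilatticeImage-⊗ : SemilatticeImage γ → SemilatticeImage β → SemilatticeImage (γ ⊗ β)
  SemilatticeImage-⊗ semiγ semiβ = record
    { comm = λ s t → EqualOn-⊗ {s ++ t} {t ++ s} (γ.comm s t)
        (trans (cong (onH β) (^^-++ s t)) (trans (β.comm (s ^^ γ) (t ^^ γ)) (cong (onH β) (sym (^^-++ t s)))))
    ; idem = λ s → EqualOn-⊗ {s ++ s} {s} (γ.idem s)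
        (trans (cong (onH β) (^^-++ s s)) (β.idem (s ^^ γ)))
    }
    where
    module γ = SemilatticeImage semiγ
    module β = SemilatticeImage semiβ

-- In the 1-definite case, reordering or duplicating summands leaves the set of root labels
-- unchanged.
SemilatticeImage-basic : ∀ {B F} {β : Hom (B ^Δ) F} → Basic β → SemilatticeImage β
SemilatticeImage-basic (into-𝒰₁ β) = record
  { comm = λ s t → trans (onH-++ β s t) (trans (∨-comm (onH β s) (onH β t)) (sym (onH-++ β t s)))
  ; idem = λ s → trans (onH-++ β s s) (∨-idem (onH β s))
  }
SemilatticeImage-basic (oneDefinite _ β definite) = record
  { comm = λ s t → definite (s ++ t) (t ++ s) (swap s t , swap t s)
  ; idem = λ s → definite (s ++ s) s (merge s , λ b∈s → subst (_ ∈_) (sym (map-++ label s s)) (∈-++⁺ˡ b∈s))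
  }
  where
  merge : ∀ s {b} → b ∈ rootLabels (s ++ s) → b ∈ rootLabels s
  merge s b∈ with ∈-++⁻ (rootLabels s) (subst (_ ∈_) (map-++ label s s) b∈)
  ... | inj₁ p = p
  ... | inj₂ p = p
  swap : ∀ s t {b} → b ∈ rootLabels (s ++ t) → b ∈ rootLabels (t ++ s)
  swap s t b∈ with ∈-++⁻ (rootLabels s) (subst (_ ∈_) (map-++ label s t) b∈)
  ... | inj₁ p = subst (_ ∈_) (sym (map-++ label t s)) (∈-++⁺ʳ (rootLabels t) p)
  ... | inj₂ p = subst (_ ∈_) (sym (map-++ label t s)) (∈-++⁺ˡ p)

SemilatticeImage-product : ∀ {A F} {γ : Hom (A ^Δ) F} → BasicProduct γ → SemilatticeImage γ
SemilatticeImage-product (single b) = SemilatticeImage-basic b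
SemilatticeImage-product (_▷_ {γ = γ} {β = β} p b) =
  SemilatticeImage-⊗ γ β (SemilatticeImage-product p) (SemilatticeImage-basic b)

Finite-basic : ∀ {B F} {β : Hom (B ^Δ) F} → Basic β → Finite (setoid (H F))
Finite-basic (into-𝒰₁ β)           = 2 , ↔-sym 2↔Bool
Finite-basic (oneDefinite fin _ _) = IsFinite.H-finite fin

Finite-product : ∀ {A F} {γ : Hom (A ^Δ) F} → BasicProduct γ → Finite (setoid (H F))
Finite-product (single b) = Finite-basic b
Finite-product (p ▷ b)    = Finite-× (Finite-product p) (Finite-basic b)

𝒰₁-·-true : ∀ v → ForestAlgebra._·_ 𝒰₁ v true ≡ true
𝒰₁-·-true true  = refl
𝒰₁-·-true false = refl

true-iff⇒≡ : ∀ {x y} → (x ≡ true → y ≡ true) → (y ≡ true → x ≡ true) → x ≡ y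
true-iff⇒≡ {true}          f g = sym (f refl)
true-iff⇒≡ {false} {true}  f g = g refl
true-iff⇒≡ {false} {false} f g = refl

-- In 𝒰₁ every vertical element fixes ∞, so mutually reachable forests agree on having value ∞. A
-- 1-definite value depends on the root labels, which depth 1 compares.
Separating-single : ∀ {A F} {β : Hom (A ^Δ) F} → Basic β → Separating β 1
Separating-single (into-𝒰₁ β) g s s′ s≼g g≼s s′≼g g≼s′ _ =
  true-iff⇒≡ (up (≼-trans β s′≼g g≼s)) (up (≼-trans β s≼g g≼s′))
  where
  up : ∀ {s t} → _≼_ β s t → onH β t ≡ true → onH β s ≡ true
  up {t = t} (p , e) e′ =
    trans e (trans (Hom.·-homo β p t) (trans (cong (ForestAlgebra._·_ 𝒰₁ (onV β p)) e′) (𝒰₁-·-true (onV β p))))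
Separating-single (oneDefinite _ β definite) g s s′ _ _ _ _ (m , n) =
  definite s s′ (sub m , sub n)
  where
  sub : ∀ {R s s′} → Matched R s s′ → ∀ {b} → b ∈ rootLabels s → b ∈ rootLabels s′
  sub {s′ = s′} m b∈ with x , x∈s , refl ← ∈-map⁻ label b∈ with y , y∈ , e , _ ← match m x∈s =
    subst (_∈ rootLabels s′) (sym e) (∈-map⁺ label y∈)

module _ {A : Set} {F : ForestAlgebra} (γ : Hom (A ^Δ) F) where

  labelᵒ : Tree A → A × H F
  labelᵒ x = label x , onH γ (children x)

  ^^-rootLabels : ∀ s → rootLabels (s ^^ γ) ≡ map labelᵒ s
  ^^-rootLabels []             = refl
  ^^-rootLabels (node a t ∷ s) = cong ((a , onH γ t) ∷_) (^^-rootLabels s)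

  Matched⇒rootLabels-⊆ : ∀ s s′ → Matched (EqualOn γ) s s′ →
                         ∀ {b} → b ∈ rootLabels (s ^^ γ) → b ∈ rootLabels (s′ ^^ γ)
  Matched⇒rootLabels-⊆ s s′ m b∈
    with x , x∈s , refl ← ∈-map⁻ labelᵒ (subst (_ ∈_) (^^-rootLabels s) b∈)
    with y , y∈ , e , e′ ← match m x∈s =
    subst (_ ∈_) (sym (^^-rootLabels s′)) (subst (_∈ map labelᵒ s′) (sym (cong₂ _,_ e e′)) (∈-map⁺ labelᵒ y∈))

  -- The first coordinate is separated by γ. A 𝒰₁-coordinate is constant on the class because ∞
  -- persists under contexts. A 1-definite coordinate needs equal γ-values of matched child forests,
  -- and the additional level of bisimilarity supplies them.
  Separating-▷ : ∀ {G} {β : Hom ((A × H F) ^Δ) G} k → Basic β → Separating γ k → Separating (γ ⊗ β) (suc k)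
  Separating-▷ k (into-𝒰₁ β) sep g s s′ s≼g g≼s s′≼g g≼s′ bisim =
    EqualOn-⊗ γ β {s} {s′}
      (sep g s s′ (≼₁ {s} {g} s≼g) (≼₁ {g} {s} g≼s) (≼₁ {s′} {g} s′≼g) (≼₁ {g} {s′} g≼s′)
        (Bisim-map (SameLabel-proj₁ γ β {g}) k (Bisim-pred k bisim)))
      (trans (sym (cong proj₂ (onH-⊗ γ β s)))
        (trans (true-iff⇒≡ (up s′ s (≼-trans δ {s′} {g} {s} s′≼g g≼s)) (up s s′ (≼-trans δ {s} {g} {s′} s≼g g≼s′)))
          (cong proj₂ (onH-⊗ γ β s′))))
    where
    δ = γ ⊗ β
    ≼₁ : ∀ {s t} → _≼_ δ s t → _≼_ γ s t
    ≼₁ {s} {t} = ≼-proj₁ γ β {s} {t}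
    flag : Forest A → Bool
    flag t = proj₂ (onH δ t)
    up : ∀ s t → _≼_ δ s t → flag t ≡ true → flag s ≡ true
    up s t (p , e) e′ = trans (cong proj₂ (trans e (Hom.·-homo δ p t)))
      (trans (cong (ForestAlgebra._·_ 𝒰₁ v) e′) (𝒰₁-·-true v))
      -- The vertical 𝒰₁-element depends on the first coordinate of the argument, but whichever it
      -- is, it fixes `true`.
      where v = proj₂ (onV δ p) (proj₁ (onH δ t))
  Separating-▷ k (oneDefinite _ β definite) sep g s s′ s≼g g≼s s′≼g g≼s′ bisim@(m , n) =
    EqualOn-⊗ γ β {s} {s′}
      (equal s s′ (s≼g , g≼s) (s′≼g , g≼s′) (Bisim-pred k bisim))
      (definite (s ^^ γ) (s′ ^^ γ)
        ( Matched⇒rootLabels-⊆ s s′ (matched λ x∈s → let y , y∈ , e , r , b = match m x∈s in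
            y , y∈ , e , child x∈s y∈ r b)
        , Matched⇒rootLabels-⊆ s′ s (matched λ x∈s → let y , y∈ , e , r , b = match n x∈s in
            y , y∈ , e , sym (child y∈ x∈s r b))))
    where
    δ = γ ⊗ β
    InClass : Forest A → Set
    InClass t = _≼_ δ t g × _≼_ δ g t
    equal : ∀ t t′ → InClass t → InClass t′ → Bisim (SameLabel δ g) k t t′ → EqualOn γ t t′
    equal t t′ (p , q) (p′ , q′) b = sep g t t′
      (≼-proj₁ γ β {t} {g} p) (≼-proj₁ γ β {g} {t} q) (≼-proj₁ γ β {t′} {g} p′) (≼-proj₁ γ β {g} {t′} q′)
      (Bisim-map (SameLabel-proj₁ γ β {g}) k b)
    child : ∀ {x y} → x ∈ s → y ∈ s′ → SameLabel δ g (children x) (children y) →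
            Bisim (SameLabel δ g) k (children x) (children y) → EqualOn γ (children x) (children y)
    child {x} {y} _ _ (inj₁ e) _ = EqualOn-proj₁ γ β {children x} {children y} e
    -- Child forests below `g` lie in the class of `g`, since `s` and `s′` are in it and are
    -- reachable from them. Separation by γ therefore applies to them at depth `k`.
    child {x} {y} x∈s y∈s′ (inj₂ (p , q)) b =
      equal (children x) (children y) (p , ≼-trans δ {g} {s} {children x} g≼s (∈⇒≼ δ {x} {s} x∈s))
            (q , ≼-trans δ {g} {s′} {children y} g≼s′ (∈⇒≼ δ {y} {s′} y∈s′)) b

Separating-product : ∀ {A F} {γ : Hom (A ^Δ) F} → BasicProduct γ → ∃ λ k → Separating γ (suc k)
Separating-product (single b) = 0 , Separating-single b
Separating-product (_▷_ {γ = γ} p b) =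
  let k , sep = Separating-product p in suc k , Separating-▷ γ (suc k) b sep

-- Separation passes to factors

module _ {A : Set} {F : ForestAlgebra} (α : Hom (A ^Δ) F) where
  open Reachability F using (_≤_)

  ≼⇒≤ : ∀ {s t} → _≼_ α s t → onH α s ≤ onH α t
  ≼⇒≤ {t = t} (p , e) = onV α p , trans e (Hom.·-homo α p t)

  module _ (surj : IsSurjective α) where
    open IsSurjective surj

    ≤-context : ∀ {h} t → h ≤ onH α t → Context A
    ≤-context t (v , _) = proj₁ (onV-surjective v)

    ≤-context-fill : ∀ {h} t (h≤ : h ≤ onH α t) → onH α (fill (≤-context t h≤) t) ≡ h
    ≤-context-fill t (v , e) = trans (Hom.·-homo α _ t)
      (trans (ForestAlgebra.·-cong F (proj₂ (onV-surjective v) refl) (onH α t)) (sym e))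

    -- Surjectivity on `V` lifts the vertical witness to a context.
    ≤⇒≼ : ∀ {s t} → onH α s ≤ onH α t → _≼_ α s t
    ≤⇒≼ {t = t} s≤t = ≤-context t s≤t , sym (≤-context-fill t s≤t)

module Cut {A : Set} {F G : ForestAlgebra} (fin : IsFinite F)
           (α : Hom (A ^Δ) F) (surj : IsSurjective α)
           (γ : Hom (A ^Δ) G) (semi : SemilatticeImage γ) (m : Forest A) where
  open IsSurjective surj
  open Reachability F using (_≤_)

  _≤m? : ∀ t → Dec (onH α t ≤ onH α m)
  t ≤m? = Reachability._≤?_ F fin (onH α t) (onH α m)

  section : H F → Forest A
  section h = proj₁ (onH-surjective h)

  -- cut k s cuts s at depth k: the subforests there are replaced by forests of
  -- the same α-value that contain m.  A subforest whose value lies strictly above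
  -- the class of m is replaced by a forest depending only on that value.
  cut   : ℕ → Forest A → Forest A
  cutAt : ∀ k t → Dec (onH α t ≤ onH α m) → Forest A
  cutᵗ  : ℕ → Tree A → Tree A

  cut k t = cutAt k t (t ≤m?)
  cutAt k       t (no _)    = section (onH α t)
  cutAt zero    t (yes t≤m) = fill (≤-context α surj m t≤m) m
  cutAt (suc k) t (yes _)   = map (cutᵗ k) t
  cutᵗ k (node a t) = node a (cut k t)

  α-cutAt : ∀ k t d → EqualOn α (cutAt k t d) t
  α-cutᵗ  : ∀ k s → EqualOn α (map (cutᵗ k) s) s

  α-cutAt k       t (no _)    = proj₂ (onH-surjective (onH α t)) refl
  α-cutAt zero    t (yes t≤m) = ≤-context-fill α surj m t≤m
  α-cutAt (suc k) t (yes _)   = α-cutᵗ k t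
  α-cutᵗ k []             = refl
  α-cutᵗ k (node a t ∷ s) = node-congᵒ α a (α-cutAt k t (t ≤m?)) (α-cutᵗ k s)

  Matched-cut : ∀ k {R S : Forest A → Forest A → Set} {s s′} →
                (∀ {t t′} → R t t′ → S (cut k t) (cut k t′)) →
                Matched R s s′ → Matched S (map (cutᵗ k) s) (map (cutᵗ k) s′)
  Matched-cut k {s = s} {s′} f M = matched go
    where
    go : ∀ {x} → x ∈ map (cutᵗ k) s → _
    go x∈ with node a t , x∈s , refl ← ∈-map⁻ (cutᵗ k) x∈
          with node _ t′ , y∈s′ , refl , r ← match M x∈s =
      node a (cut k t′) , ∈-map⁺ (cutᵗ k) y∈s′ , refl , f r

  SameLabel-≤ : ∀ {t t′} → SameLabel α m t t′ → onH α t ≤ onH α m → onH α t′ ≤ onH α m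
  SameLabel-≤ l t≤m = ≼⇒≤ α (SameLabel-resp α l (≤⇒≼ α surj t≤m))

  -- Forests not below `m` have equal values and are cut to the same section. At depth 0 both cuts
  -- contain `m`. Above that depth the child forests agree by induction, and `Matched⇒SameLabel`
  -- carries the agreement up to the parents.
  cut-bisim : ∀ k {t t′} → SameLabel α m t t′ → Bisim (SameLabel α m) k t t′ →
              SameLabel γ m (cut k t) (cut k t′) × Bisim (SameLabel γ m) k (cut k t) (cut k t′)
  cut-bisim k {t} {t′} l b with t ≤m? | t′ ≤m?
  ... | yes p | no ¬q = contradiction (SameLabel-≤ l p) ¬q
  ... | no ¬p | yes q = contradiction (SameLabel-≤ (SameLabel-sym α l) q) ¬p
  ... | no ¬p | no _  with l
  ...   | inj₂ (t≼m , _) = contradiction (≼⇒≤ α t≼m) ¬p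
  ...   | inj₁ e rewrite e = inj₁ refl , Bisim-refl (inj₁ refl) k
  cut-bisim zero    l b | yes p | yes q = inj₂ ((≤-context α surj m p , refl) , (≤-context α surj m q , refl)) , _
  cut-bisim (suc k) l (M , N) | yes p | yes q =
    Matched⇒SameLabel γ semi (Matched-map proj₁ M′) (Matched-map proj₁ N′) , M′ , N′
    where
    M′ = Matched-cut k (λ (l , b) → cut-bisim k l b) M
    N′ = Matched-cut k (λ (l , b) → cut-bisim k l b) N

module _ {A : Set} {F G : ForestAlgebra} (fin : IsFinite F)
         (α : Hom (A ^Δ) F) (surj : IsSurjective α) (γ : Hom (A ^Δ) G)
         (finG : Finite (setoid (H G))) (factors : α FactorsThrough γ) where
  open ForestAlgebra G using (_·_; ·-assoc)

  private
    infix 4 _≤ⁱ_ _⊏_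
    -- The relation `≼` of γ moved to values, where finiteness of `H G` yields well-foundedness.
    _≤ⁱ_ : H G → H G → Set
    h ≤ⁱ h′ = ∃ λ p → h ≡ onV γ p · h′

    _⊏_ : H G → H G → Set
    h ⊏ h′ = h ≤ⁱ h′ × ¬ (h′ ≤ⁱ h)

    ≤ⁱ-trans : ∀ {h h′ h″} → h ≤ⁱ h′ → h′ ≤ⁱ h″ → h ≤ⁱ h″
    ≤ⁱ-trans {h″ = h″} (p , refl) (q , refl) = p ⊙ q ,
      trans (sym (·-assoc _ _ h″)) (sym (ForestAlgebra.·-cong G (homo p q) h″))
      where open MonoidMorphisms.IsMonoidHomomorphism (Hom.onV-homo γ)

    ⊏-wellFounded : WellFounded _⊏_
    ⊏-wellFounded = Finite⇒wellFounded finG (λ (p , ¬p) → ¬p p)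
      λ (p , ¬p) (q , _) → ≤ⁱ-trans p q , λ r → ¬p (≤ⁱ-trans q r)

    ≼⇒≤ⁱ : ∀ {s t} → _≼_ γ s t → onH γ s ≤ⁱ onH γ t
    ≼⇒≤ⁱ {t = t} (p , e) = p , trans e (Hom.·-homo γ p t)

    ≤ⁱ⇒≼ : ∀ {s t} → onH γ s ≤ⁱ onH γ t → _≼_ γ s t
    ≤ⁱ⇒≼ {t = t} (p , e) = p , trans e (sym (Hom.·-homo γ p t))

  -- Among the forests in the α-class of `s`, `m` lies in a lowest γ-class. The double negation
  -- spares a decision of reachability in the image of γ.
  Minimal : Forest A → Forest A → Set
  Minimal s m = _≼_ α s m × _≼_ α m s ×
    (∀ t → _≼_ α s t → _≼_ γ t m → ¬ ¬ (_≼_ γ m t))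

  ≼-factors : ∀ {s t} → _≼_ γ s t → _≼_ α s t
  ≼-factors (p , e) = p , factors _ _ e

  -- Descent along `⊏`: a failure of minimality at `m` gives a forest strictly below it for γ that
  -- is still in the α-class of `s`, because α factors through γ.
  minimal-exists : ∀ s → ¬ ¬ ∃ (Minimal s)
  minimal-exists s = below s (⊏-wellFounded _) (EqualOn⇒≼ α refl) (EqualOn⇒≼ α refl)
    where
    below : ∀ m → Acc _⊏_ (onH γ m) → _≼_ α s m → _≼_ α m s → ¬ ¬ ∃ (Minimal s)
    below m (acc rec) s≼m m≼s none = none (m , s≼m , m≼s , λ t s≼t t≼m m⋠t →
      below t (rec (≼⇒≤ⁱ t≼m , m⋠t ∘ ≤ⁱ⇒≼)) s≼t (≼-trans α (≼-factors t≼m) m≼s) none)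

  -- Equality in F is decidable, so a γ-minimal representative m of the class may
  -- be used although it is not computed; cutting at m turns forests that are
  -- similar for α into forests similar for γ.
  Separating-factor : SemilatticeImage γ → ∀ {k} → Separating γ k → Separating α k
  Separating-factor semi {k} sep g s s′ s≼g g≼s s′≼g g≼s′ bisim =
    decidable-stable (Reachability._≟_ F fin (onH α s) (onH α s′)) λ s≢s′ →
      minimal-exists g λ (m , g≼m , m≼g , min) →
        let open Cut fin α surj γ semi m
            relabel : ∀ {t t′} → SameLabel α g t t′ → SameLabel α m t t′
            relabel = λ { (inj₁ e) → inj₁ e
                        ; (inj₂ (p , q)) → inj₂ (≼-trans α p g≼m , ≼-trans α q g≼m) }
            α-cut = λ t → α-cutAt k t (t ≤m?)
            g≼cut = λ t g≼t → ≼-trans α {g} {t} {cut k t} g≼t (EqualOn⇒≼ α (sym (α-cut t)))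
            conclude = λ e → s≢s′ (trans (sym (α-cut s)) (trans (factors (cut k s) (cut k s′) e) (α-cut s′)))
            l , b = cut-bisim k {s} {s′} (inj₂ (≼-trans α s≼g g≼m , ≼-trans α s′≼g g≼m))
                      (Bisim-map relabel k bisim)
        -- The cuts either have equal γ-values or both lie γ-below `m`. In the latter case
        -- minimality puts them in the γ-class of `m`, where γ separates.
        in [ conclude , (λ (c≼m , c′≼m) →
             min (cut k s) (g≼cut s g≼s) c≼m λ m≼c →
             min (cut k s′) (g≼cut s′ g≼s′) c′≼m λ m≼c′ →
             conclude (sep m (cut k s) (cut k s′) c≼m m≼c c′≼m m≼c′ b)) ]′ l

-- Similarity of relabelled forests as bisimilarity

module _ {A : Set} {F : ForestAlgebra} (γ : Hom (A ^Δ) F) where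

  branch : Tree A → (A × H F) × Forest (A × H F)
  branch x = (label x , onH γ (children x)) , children x ^^ γ

  branches-^^ : ∀ s → branches (s ^^ γ) ≡ map branch s
  branches-^^ []             = refl
  branches-^^ (node a t ∷ s) = cong (_ ∷_) (branches-^^ s)

  private
    ∼-branch : ℕ → Setoid 0ℓ 0ℓ
    ∼-branch k = ×-setoid (setoid (A × H F)) (∼-setoid {A × H F} k)

  ⊆⇒Matched : ∀ k {s s′} → SetoidSubset._⊆_ (∼-branch k) (branches (s ^^ γ)) (branches (s′ ^^ γ)) →
              Matched (λ t t′ → EqualOn γ t t′ × (t ^^ γ) ∼[ k ] (t′ ^^ γ)) s s′
  ⊆⇒Matched k {s} {s′} sub rewrite branches-^^ s | branches-^^ s′ = matched λ {x} x∈s →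
    let open Setoid (∼-branch k) using () renaming (reflexive to ≈-reflexive)
        x∈ = AnyProperties.map⁺ (Any.map (λ eq → ≈-reflexive (cong branch eq)) x∈s)
        y , y∈s′ , e , e′ = find (AnyProperties.map⁻ (sub {branch x} x∈))
    in y , y∈s′ , cong proj₁ e , cong proj₂ e , e′

  Matched⇒⊆ : ∀ k {s s′} → Matched (λ t t′ → EqualOn γ t t′ × (t ^^ γ) ∼[ k ] (t′ ^^ γ)) s s′ →
              SetoidSubset._⊆_ (∼-branch k) (branches (s ^^ γ)) (branches (s′ ^^ γ))
  Matched⇒⊆ k {s} {s′} M {b} b∈ rewrite branches-^^ s | branches-^^ s′ =
    let open Setoid (∼-branch k) using () renaming (trans to ≈-trans)
        x , x∈s , e = find (AnyProperties.map⁻ b∈)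
        y , y∈s′ , l , r , e′ = match M x∈s
    in AnyProperties.map⁺ (lose y∈s′ (≈-trans {b} {branch x} {branch y} e (cong₂ _,_ l r , e′)))

  ∼⇒Bisim : ∀ k {s s′} → (s ^^ γ) ∼[ k ] (s′ ^^ γ) → Bisim (EqualOn γ) k s s′
  ∼⇒Bisim zero    _       = _
  ∼⇒Bisim (suc k) {s} {s′} (p , q) =
    Matched-map (λ (e , b) → e , ∼⇒Bisim k b) (⊆⇒Matched k {s} {s′} p) ,
    Matched-map (λ {t} {t′} (e , b) → sym e , ∼⇒Bisim k (IsEquivalence.sym (∼-isEquivalence k) {t ^^ γ} {t′ ^^ γ} b))
      (⊆⇒Matched k {s′} {s} q)

  Bisim⇒∼ : ∀ k {s s′} → Bisim (EqualOn γ) k s s′ → (s ^^ γ) ∼[ k ] (s′ ^^ γ)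
  Bisim⇒∼ zero    _       = _
  Bisim⇒∼ (suc k) {s} {s′} (M , N) =
    Matched⇒⊆ k {s} {s′} (Matched-map (λ (e , b) → e , Bisim⇒∼ k b) M) ,
    Matched⇒⊆ k {s′} {s} (Matched-map (λ {t} {t′} (e , b) → sym e ,
      IsEquivalence.sym (∼-isEquivalence k) {t′ ^^ γ} {t ^^ γ} (Bisim⇒∼ k b)) N)

module _ {F : ForestAlgebra} (fin : IsFinite F) where
  open Reachability F

  ≯⇒≤ : ∀ {h g} → g ≤ h → ¬ (h >[ g ]) → h ≤ g
  ≯⇒≤ {h} {g} g≤h h≯g = decidable-stable (_≤?_ fin h g) λ h≰g → h≯g (g≤h , λ (h≤g , _) → h≰g h≤g)

  module _ {g : H F} where
    open AtClass fin g

    []-injective : ∀ {h h′} → [ h ] ≡ [ h′ ] → h ≡ h′ ⊎ (¬ (h >[ g ]) × ¬ (h′ >[ g ]))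
    []-injective {h} {h′} e with _>?[_] fin h g | _>?[_] fin h′ g
    []-injective refl | yes _ | yes _  = inj₁ refl
    []-injective ()   | yes _ | no _
    []-injective ()   | no _  | yes _
    []-injective e    | no p  | no q   = inj₂ (p , q)

-- Factoring through a product implies nonconfusion

module _ {A : Set} {F : ForestAlgebra} (fin : IsFinite F) (α : Hom (A ^Δ) F) where
  open Reachability F

  EFEX⇒Nonconfusing : IsSurjective α → EFEXHomomorphism α → Nonconfusing fin α
  EFEX⇒Nonconfusing surj (G , γ , product , factors) =
    let k , sep = Separating-product product
        sepα    = Separating-factor fin α surj γ (Finite-product product) factors
                    (SemilatticeImage-product product) sep
    in suc k , s≤s z≤n , λ g s s′ (s∼s′ , (s≤g , g≤s) , (s′≤g , g≤s′)) →
      sepα s s s′ (EqualOn⇒≼ α refl) (EqualOn⇒≼ α refl)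
        (≤⇒≼ α surj (≤-transitive s′≤g g≤s)) (≤⇒≼ α surj (≤-transitive s≤g g≤s′))
        (relabel g≤s (suc k) g≤s g≤s′ (∼⇒Bisim (quotientAt fin α g) (suc k) s∼s′))
    where
    -- Every subforest of a forest above or in the class of `g` is again above or in it. Two such
    -- subforests labelled ∞ hence both lie in this class, and so below `s`.
    relabel : ∀ {g s} → g ≤ onH α s → ∀ k {t t′} → g ≤ onH α t → g ≤ onH α t′ →
              Bisim (EqualOn (quotientAt fin α g)) k t t′ → Bisim (SameLabel α s) k t t′
    relabel g≤s zero    _ _ _ = _
    relabel {g} {s} g≤s (suc k) {t} {t′} g≤t g≤t′ (M , N) =
        matched (λ x∈t → let y , y∈t′ , l , e , b = match M x∈t in
          y , y∈t′ , l , child x∈t y∈t′ e , relabel g≤s k (above g≤t x∈t) (above g≤t′ y∈t′) b)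
      , matched (λ y∈t′ → let x , x∈t , l , e , b = match N y∈t′ in
          x , x∈t , l , child x∈t y∈t′ e , relabel g≤s k (above g≤t x∈t) (above g≤t′ y∈t′) b)
      where
      above : ∀ {t x} → g ≤ onH α t → x ∈ t → g ≤ onH α (children x)
      above g≤t x∈t = ≤-transitive g≤t (≼⇒≤ α (∈⇒≼ α x∈t))
      child : ∀ {x y} → x ∈ t → y ∈ t′ → EqualOn (quotientAt fin α g) (children x) (children y) →
              SameLabel α s (children x) (children y)
      child x∈t y∈t′ e with []-injective fin {g} e
      ... | inj₁ e′            = inj₁ e′
      ... | inj₂ (x≯g , y≯g)   = inj₂
        ( ≤⇒≼ α surj (≤-transitive (≯⇒≤ fin (above g≤t x∈t) x≯g) g≤s)
        , ≤⇒≼ α surj (≤-transitive (≯⇒≤ fin (above g≤t′ y∈t′) y≯g) g≤s))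

-- Functions computed by products of basic homomorphisms

module Search {A X : Set} (finA : Finite (setoid A)) (finX : Finite (setoid X)) (eval : Forest A → X)
              (compositional : ∀ a {t t′ s s′} → eval t ≡ eval t′ → eval s ≡ eval s′ →
                               eval (node a t ∷ s) ≡ eval (node a t′ ∷ s′)) where

  Represented : List (Forest A) → Forest A → Set
  Represented R s = Any (λ r → eval r ≡ eval s) R

  represented? : ∀ R s → Dec (Represented R s)
  represented? R s = Any.any? (λ r → Finite⇒≟ finX (eval r) (eval s)) R

  candidates : List (Forest A) → List (Forest A)
  candidates R =
    [] ∷ cartesianProductWith (λ a (t , s) → node a t ∷ s) (enumerate finA) (cartesianProduct R R)

  closed⇒represented : ∀ R → All (Represented R) (candidates R) → ∀ s → Represented R s
  closed⇒represented R closed []             = All.head closed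
  closed⇒represented R closed (node a t ∷ s) =
    let r  , r∈  , e  = find (closed⇒represented R closed t)
        r′ , r′∈ , e′ = find (closed⇒represented R closed s)
    in Any.map (λ eq → trans eq (compositional a e e′))
         (All.lookup closed (there (∈-cartesianProductWith⁺ (λ a (t , s) → node a t ∷ s)
           (∈-enumerate finA a) (∈-cartesianProduct⁺ r∈ r′∈))))

  -- `U` lists the values that `R` may still miss. A candidate built from `R` but not represented in
  -- it has its value in `U`; adding the candidate to `R` allows that value to be struck out, so `U`
  -- shrinks.
  saturate : ∀ U → Acc _<_ (length U) → ∀ R → (∀ s → Represented R s ⊎ eval s ∈ U) →
             ∃ λ R → ∀ s → Represented R s
  saturate U (acc rec) R cover with All.all? (represented? R) (candidates R)
  ... | yes closed = R , closed⇒represented R closed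
  ... | no ¬closed with s , _ , ¬rep ← find (¬All⇒Any¬ (represented? R) _ ¬closed) with cover s
  ...   | inj₁ rep = contradiction rep ¬rep
  ...   | inj₂ s∈U = saturate (filter new? U) (rec (filter-notAll new? U (lose s∈U (λ ≢ → ≢ refl)))) (s ∷ R) cover′
    where
    new? = λ x → ¬? (Finite⇒≟ finX (eval s) x)
    cover′ : ∀ s′ → Represented (s ∷ R) s′ ⊎ eval s′ ∈ filter new? U
    cover′ s′ with Finite⇒≟ finX (eval s) (eval s′) | cover s′
    ... | yes e | _        = inj₁ (here e)
    ... | no _  | inj₁ rep = inj₁ (there rep)
    ... | no ≢  | inj₂ s′∈ = inj₂ (∈-filter⁺ new? s′∈ ≢)

  representatives : ∃ λ R → ∀ s → Represented R s
  representatives = saturate (enumerate finX) (<-wellFounded _) [] λ s → inj₂ (∈-enumerate finX (eval s))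

  search : {Q : Forest A → Set} → (∀ s → Dec (Q s)) →
           (∀ {s s′} → eval s ≡ eval s′ → Q s → Q s′) → Dec (∃ Q)
  search Q? resp with R , rep ← representatives =
    map′ (λ a → let s , _ , q = find a in s , q)
         (λ (s , q) → Any.map (λ e → resp (sym e) q) (rep s))
         (Any.any? Q? R)

module _ {A : Set} where

  someRoot someNode : (A → Forest A → Bool) → Forest A → Bool
  someRoot ψ []             = false
  someRoot ψ (node a t ∷ s) = ψ a t ∨ someRoot ψ s
  someNode ψ []             = false
  someNode ψ (node a t ∷ s) = (ψ a t ∨ someNode ψ t) ∨ someNode ψ s

  ∈⇒someRoot : ∀ ψ {x s} → x ∈ s → ψ (label x) (children x) ≡ true → someRoot ψ s ≡ true
  ∈⇒someRoot ψ {node a t} (here refl) e rewrite e = refl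
  ∈⇒someRoot ψ {x} {node b u ∷ s} (there x∈s) e =
    trans (cong (ψ b u ∨_) (∈⇒someRoot ψ x∈s e)) (∨-zeroʳ (ψ b u))

  someRoot⇒∈ : ∀ ψ s → someRoot ψ s ≡ true → ∃ λ x → x ∈ s × ψ (label x) (children x) ≡ true
  someRoot⇒∈ ψ (node a t ∷ s) e with ψ a t in eq
  ... | true  = node a t , here refl , eq
  ... | false = let x , x∈s , e′ = someRoot⇒∈ ψ s e in x , there x∈s , e′

-- The vertical elements are the identity and the two constant maps.
root-algebra : ForestAlgebra
root-algebra = record
  { H          = Bool
  ; _+_        = _∨_
  ; 0#         = false
  ; +-isMonoid = ∨-isMonoid
  ; V-monoid   = <∣>-monoid Bool
  ; _·_        = λ v h → fromMaybe h v
  ; ·-cong     = λ { refl _ → refl }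
  ; ·-identity = λ _ → refl
  ; ·-assoc    = λ { (just _) _ _ → refl ; nothing _ _ → refl }
  ; faithful   = λ { {just _}  {just _}  eq → cong just (eq true)
                   ; {just _}  {nothing} eq → contradiction (trans (sym (eq true)) (eq false)) λ ()
                   ; {nothing} {just _}  eq → contradiction (trans (eq true) (sym (eq false))) λ ()
                   ; {nothing} {nothing} _  → refl }
  ; [_+□]      = add
  ; [□+_]      = add
  ; +□-act     = λ { true _ → refl ; false _ → refl }
  ; □+-act     = λ { true h → sym (∨-zeroʳ h) ; false h → sym (∨-identityʳ h) }
  }
  where
  add : Bool → Maybe Bool
  add true  = just true
  add false = nothing

root-algebra-finite : IsFinite root-algebra
root-algebra-finite = record
  { H-finite = 2 , ↔-sym 2↔Bool
  ; V-finite = 3 , mk↔ₛ′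
      (λ { nothing → zero ; (just b) → suc (Inverse.from 2↔Bool b) })
      (λ { zero → nothing ; (suc i) → just (Inverse.to 2↔Bool i) })
      (λ { zero → refl ; (suc i) → cong suc (Inverse.strictlyInverseʳ 2↔Bool i) })
      (λ { nothing → refl ; (just b) → cong just (Inverse.strictlyInverseˡ 2↔Bool b) })
  }

module _ {B : Set} (ψ : B → Bool) where

  rootHom : Hom (B ^Δ) root-algebra
  rootHom = extend root-algebra (just ∘ ψ)

  onH-rootHom : ∀ s → onH rootHom s ≡ someRoot (λ b _ → ψ b) s
  onH-rootHom []             = refl
  onH-rootHom (node b t ∷ s) = cong (ψ b ∨_) (onH-rootHom s)

  rootHom-basic : Basic rootHom
  rootHom-basic = oneDefinite root-algebra-finite rootHom λ s s′ (p , q) →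
    trans (onH-rootHom s) (trans (true-iff⇒≡ (transfer s s′ p) (transfer s′ s q)) (sym (onH-rootHom s′)))
    where
    transfer : ∀ s s′ → (∀ {b} → b ∈ rootLabels s → b ∈ rootLabels s′) →
               someRoot (λ b _ → ψ b) s ≡ true → someRoot (λ b _ → ψ b) s′ ≡ true
    transfer s s′ sub e =
      let x , x∈s , e′ = someRoot⇒∈ (λ b _ → ψ b) s e
          y , y∈s′ , l = ∈-map⁻ label (sub (∈-map⁺ label x∈s))
      in ∈⇒someRoot (λ b _ → ψ b) y∈s′ (trans (cong ψ (sym l)) e′)

  -- The negation arises because vertical `false` is the constant map to ∞: a node satisfying `ψ`
  -- produces ∞, and any other node passes on the value of its children.
  nodeHom : Hom (B ^Δ) 𝒰₁
  nodeHom = extend 𝒰₁ (not ∘ ψ)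

  onH-nodeHom : ∀ s → onH nodeHom s ≡ someNode (λ b _ → ψ b) s
  onH-nodeHom []             = refl
  onH-nodeHom (node b t ∷ s) with ψ b
  ... | true  = refl
  ... | false = cong₂ _∨_ (onH-nodeHom t) (onH-nodeHom s)

-- `restrict` recovers the value of γ, so outputs obtained earlier stay readable after further
-- factors are appended.
record Computing {A : Set} {F : ForestAlgebra} (γ : Hom (A ^Δ) F)
                 {X : Set} (P : Forest A → X) : Set₁ where
  field
    {G}        : ForestAlgebra
    {δ}        : Hom (A ^Δ) G
    product    : BasicProduct δ
    restrict   : H G → H F
    restrict-δ : ∀ s → restrict (onH δ s) ≡ onH γ s
    output     : H G → X
    output-δ   : ∀ s → output (onH δ s) ≡ P s

-- Quantifying over the product to be extended makes definable functions closed
-- under pairing without a separate lemma on joining products.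
Definable : {A X : Set} → (Forest A → X) → Set₁
Definable {A} P = ∀ {F} {γ : Hom (A ^Δ) F} → BasicProduct γ → Computing γ P

module _ {A : Set} where

  Definable-const : {X : Set} (x : X) → Definable {A} λ _ → x
  Definable-const x product = record
    { product = product ; restrict = id ; restrict-δ = λ _ → refl ; output = λ _ → x ; output-δ = λ _ → refl }

  Definable-map : {X Y : Set} {P : Forest A → X} {Q : Forest A → Y} (f : X → Y) →
                  (∀ s → f (P s) ≡ Q s) → Definable P → Definable Q
  Definable-map f f-P P-def product = record
    { Computing (P-def product) using (product; restrict; restrict-δ)
    ; output   = f ∘ C.output
    ; output-δ = λ s → trans (cong f (C.output-δ s)) (f-P s)
    }
    where module C = Computing (P-def product)

  Definable-× : {X Y : Set} {P : Forest A → X} {Q : Forest A → Y} →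
                Definable P → Definable Q → Definable λ s → P s , Q s
  Definable-× P-def Q-def product = record
    { product    = D.product
    ; restrict   = C.restrict ∘ D.restrict
    ; restrict-δ = λ s → trans (cong C.restrict (D.restrict-δ s)) (C.restrict-δ s)
    ; output     = λ h → C.output (D.restrict h) , D.output h
    ; output-δ   = λ s → cong₂ _,_ (trans (cong C.output (D.restrict-δ s)) (C.output-δ s)) (D.output-δ s)
    }
    where
    module C = Computing (P-def product)
    module D = Computing (Q-def C.product)

  -- A finite family is packed into one code, on which equality is decidable and from which each
  -- member can be recovered.
  Definable-funToFin : ∀ {m} n {P : Fin n → Forest A → Fin m} →
                       (∀ i → Definable (P i)) → Definable λ s → funToFin λ i → P i s
  Definable-funToFin zero    P-def = Definable-const zero
  Definable-funToFin (suc n) P-def =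
    Definable-map (λ (i , j) → combine i j) (λ _ → refl)
      (Definable-× (P-def zero) (Definable-funToFin n (P-def ∘ suc)))

  module _ {X : Set} {Q : Forest A → X} (ψ : A → X → Bool) (Q-def : Definable Q) where

    someRoot-^^ : ∀ {G} (δ : Hom (A ^Δ) G) (out : H G → X) → (∀ s → out (onH δ s) ≡ Q s) → ∀ s →
                  someRoot (λ (a , h) _ → ψ a (out h)) (s ^^ δ) ≡ someRoot (λ a t → ψ a (Q t)) s
    someRoot-^^ δ out eq []             = refl
    someRoot-^^ δ out eq (node a t ∷ s) = cong₂ _∨_ (cong (ψ a) (eq t)) (someRoot-^^ δ out eq s)

    someNode-^^ : ∀ {G} (δ : Hom (A ^Δ) G) (out : H G → X) → (∀ s → out (onH δ s) ≡ Q s) → ∀ s →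
                  someNode (λ (a , h) _ → ψ a (out h)) (s ^^ δ) ≡ someNode (λ a t → ψ a (Q t)) s
    someNode-^^ δ out eq []             = refl
    someNode-^^ δ out eq (node a t ∷ s) =
      cong₂ _∨_ (cong₂ _∨_ (cong (ψ a) (eq t)) (someNode-^^ δ out eq t)) (someNode-^^ δ out eq s)

    -- The letters of an appended factor are pairs of a letter and the value of the child forest,
    -- from which `Q` of that child forest is read.
    Definable-someRoot : Definable (someRoot λ a t → ψ a (Q t))
    Definable-someRoot product = record
      { product    = C.product ▷ rootHom-basic ψ′
      ; restrict   = C.restrict ∘ proj₁
      ; restrict-δ = λ s → trans (cong (C.restrict ∘ proj₁) (onH-⊗ C.δ (rootHom ψ′) s)) (C.restrict-δ s)
      ; output     = proj₂
      ; output-δ   = λ s → trans (cong proj₂ (onH-⊗ C.δ (rootHom ψ′) s))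
          (trans (onH-rootHom ψ′ (s ^^ C.δ)) (someRoot-^^ C.δ C.output C.output-δ s))
      }
      where
      module C = Computing (Q-def product)
      ψ′ : A × H C.G → Bool
      ψ′ (a , h) = ψ a (C.output h)

    Definable-someNode : Definable (someNode λ a t → ψ a (Q t))
    Definable-someNode product = record
      { product    = C.product ▷ into-𝒰₁ (nodeHom ψ′)
      ; restrict   = C.restrict ∘ proj₁
      ; restrict-δ = λ s → trans (cong (C.restrict ∘ proj₁) (onH-⊗ C.δ (nodeHom ψ′) s)) (C.restrict-δ s)
      ; output     = proj₂
      ; output-δ   = λ s → trans (cong proj₂ (onH-⊗ C.δ (nodeHom ψ′) s))
          (trans (onH-nodeHom ψ′ (s ^^ C.δ)) (someNode-^^ C.δ C.output C.output-δ s))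
      }
      where
      module C = Computing (Q-def product)
      ψ′ : A × H C.G → Bool
      ψ′ (a , h) = ψ a (C.output h)

  -- A product to start from, since products have at least one factor.
  trivial-product : BasicProduct {A} (extend 𝒰₁ λ _ → true)
  trivial-product = single (into-𝒰₁ _)

-- Nonconfusing homomorphisms are computed by such products

bit : Bool → Fin 2
bit = Inverse.from 2↔Bool

bit-injective : ∀ {x y} → bit x ≡ bit y → x ≡ y
bit-injective {x} {y} e = trans (sym (Inverse.strictlyInverseˡ 2↔Bool x))
  (trans (cong (Inverse.to 2↔Bool) e) (Inverse.strictlyInverseˡ 2↔Bool y))

funToFin-injective : ∀ {m n} {f g : Fin n → Fin m} → funToFin f ≡ funToFin g → ∀ i → f i ≡ g i
funToFin-injective {f = f} {g} e i =
  trans (sym (finToFun-funToFin f i)) (trans (cong (λ x → finToFun x i) e) (finToFun-funToFin g i))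

does⇒ : {P : Set} (d : Dec P) → does d ≡ true → P
does⇒ (yes p) _ = p

module _ {A : Set} (finA : Finite (setoid A)) {N : ℕ} {c : Forest A → Fin N} (c-def : Definable c) where

  private
    _≈ᶜ_ : Forest A → Forest A → Set
    t ≈ᶜ t′ = c t ≡ c t′

  record TypeCode (k : ℕ) : Set₁ where
    field
      {size}    : ℕ
      code      : Forest A → Fin size
      definable : Definable code
      sound     : ∀ {s s′} → code s ≡ code s′ → Bisim _≈ᶜ_ k s s′

  -- The code of depth `suc k` is the characteristic vector of the set of root branches, a branch
  -- being coded by its letter, `c` and the code of depth `k`. Each bit is a test on roots, hence
  -- definable by a 1-definite layer.
  typeCode : ∀ k → TypeCode k
  typeCode zero    = record { code = λ _ → zero {0} ; definable = Definable-const zero }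
  typeCode (suc k) = record
    { code      = λ s → funToFin λ j → bit (has j s)
    ; definable = Definable-funToFin _ λ j → Definable-map bit (λ _ → refl)
        (Definable-someRoot (λ a x → does (combine (toA a) x Fin.≟ j))
          (Definable-map (λ (x , y) → combine x y) (λ _ → refl) (Definable-× c-def T.definable)))
    ; sound     = λ {s} {s′} e →
        let has≡ = λ j → bit-injective (funToFin-injective e j)
        in matched (λ x∈s → let y , y∈s′ , e′ = counterpart s s′ has≡ x∈s
                                l , e₁ , e₂   = branchCode-injective (sym e′)
                            in y , y∈s′ , l , e₁ , T.sound e₂)
         , matched (λ y∈s′ → let x , x∈s , e′ = counterpart s′ s (sym ∘ has≡) y∈s′
                                 l , e₁ , e₂  = branchCode-injective e′
                             in x , x∈s , sym l , e₁ , T.sound e₂)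
    }
    where
    module T = TypeCode (typeCode k)
    toA = Inverse.to (proj₂ finA)
    branchCode : A → Forest A → Fin (proj₁ finA * (N * T.size))
    branchCode a t = combine (toA a) (combine (c t) (T.code t))
    has : Fin (proj₁ finA * (N * T.size)) → Forest A → Bool
    has j = someRoot λ a t → does (branchCode a t Fin.≟ j)
    branchCode-injective : ∀ {a b t u} → branchCode a t ≡ branchCode b u → a ≡ b × t ≈ᶜ u × T.code t ≡ T.code u
    branchCode-injective {a} {b} {t} {u} e =
      let e₁ , e′ = combine-injective (toA a) (combine (c t) (T.code t)) (toA b) (combine (c u) (T.code u)) e
      in Injection.injective (Inverse⇒Injection (proj₂ finA)) e₁
       , combine-injective (c t) (T.code t) (c u) (T.code u) e′
    counterpart : ∀ s s′ → (∀ j → has j s ≡ has j s′) → ∀ {x} → x ∈ s → ∃ λ y → y ∈ s′ ×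
                  branchCode (label y) (children y) ≡ branchCode (label x) (children x)
    counterpart s s′ has≡ {x} x∈s =
      let j = branchCode (label x) (children x)
          y , y∈s′ , e = someRoot⇒∈ _ s′ (trans (sym (has≡ j))
                           (∈⇒someRoot _ x∈s (dec-true (j Fin.≟ j) refl)))
      in y , y∈s′ , does⇒ (_ Fin.≟ j) e

-- Recognizing a single value, by induction on classes

module _ {A : Set} (finA : Finite (setoid A)) {F : ForestAlgebra} (fin : IsFinite F)
         (α : Hom (A ^Δ) F) (semi : SemilatticeImage α)
         (k : ℕ) (nonconfusing : ∀ g s s′ → _≡[_,_]_ fin α s k g s′ → onH α s ≡ onH α s′) where
  open Reachability F
  private
    infix 4 _≟ʰ_
    _≟ʰ_ : DecidableEquality (H F)
    _≟ʰ_ = _≟_ fin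
    module I = Inverse (proj₂ (IsFinite.H-finite fin))

  module Recognition (g : H F) {M : ℕ} {profile : Forest A → Fin M} (profile-definable : Definable profile)
                     (profile-sound : ∀ {s s′} → profile s ≡ profile s′ →
                        Matched (λ t t′ → g ≤ onH α t → g ≤ onH α t′ → onH α t ≡ onH α t′) s s′) where

    Realizable : Fin M → Set
    Realizable x = ∃ λ t → g ≤ onH α t × profile t ≡ x

    -- α together with a product computing the profile takes finitely many values
    -- and is compositional, which makes realizability decidable.
    realizable? : ∀ x → Dec (Realizable x)
    realizable? x = search (λ t → _≤?_ fin g (onH α t) ×-dec (profile t Fin.≟ x))
      λ e (g≤t , p≡x) → subst (g ≤_) (cong proj₁ e) g≤t ,
        trans (trans (sym (C.output-δ _)) (trans (cong (C.output ∘ proj₂) (sym e)) (C.output-δ _))) p≡x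
      where
      module C = Computing (profile-definable (trivial-product {A}))
      open Search finA (Finite-× (IsFinite.H-finite fin) (Finite-product C.product))
        (λ s → onH α s , onH C.δ s)
        (λ a {t} {t′} {s} {s′} e e′ →
          cong₂ _,_ (node-congᵒ α a {t} {t′} {s} {s′} (cong proj₁ e) (cong proj₁ e′))
                    (node-congᵒ C.δ a {t} {t′} {s} {s′} (cong proj₂ e) (cong proj₂ e′)))

    module _ (realizable? : ∀ x → Dec (Realizable x)) where

      bad : A → Fin M → Bool
      bad _ x = not (does (realizable? x))

      someBad : Forest A → Bool
      someBad = someNode λ a t → bad a (profile t)

      above-children : ∀ {s x} → g ≤ onH α s → x ∈ s → g ≤ onH α (children x)
      above-children g≤s x∈s = ≤-transitive g≤s (≼⇒≤ α (∈⇒≼ α x∈s))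

      above⇒¬bad : ∀ s → g ≤ onH α s → someBad s ≡ false
      above⇒¬bad []             _   = refl
      above⇒¬bad (node a t ∷ s) g≤s = cong₂ _∨_
        (cong₂ _∨_ (cong not (dec-true (realizable? (profile t)) (t , g≤t , refl))) (above⇒¬bad t g≤t))
        (above⇒¬bad s (≤-transitive g≤s (≼⇒≤ α (∷-≼ α (node a t) s))))
        where g≤t = above-children {node a t ∷ s} {node a t} g≤s (here refl)

      -- Mutual induction. A child forest `t` without bad nodes has a realizable profile, so it
      -- shares its value with a forest above or in the class and lies there itself. Once this holds
      -- for all child forests, the profile determines their values and thus the sum.
      ¬bad⇒value : ∀ s → someBad s ≡ false → ∀ {s′} → g ≤ onH α s′ → profile s′ ≡ profile s → onH α s′ ≡ onH α s
      ¬bad⇒above : ∀ s → someBad s ≡ false → ∀ {x} → x ∈ s → g ≤ onH α (children x)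

      ¬bad⇒value s ok {s′} g≤s′ e = Matched⇒EqualOn α semi
        (matched λ x∈ → let y , y∈ , l , determined = match (profile-sound e) x∈ in
          y , y∈ , l , determined (above-children g≤s′ x∈) (¬bad⇒above s ok y∈))
        (matched λ y∈ → let x , x∈ , l , determined = match (profile-sound (sym e)) y∈ in
          x , x∈ , l , determined (¬bad⇒above s ok y∈) (above-children g≤s′ x∈))

      ¬bad⇒above (node a t ∷ s) ok (there x∈s) = ¬bad⇒above s (∨-conicalʳ _ (someBad s) ok) x∈s
      ¬bad⇒above (node a t ∷ s) ok (here refl) =
        let ok′ = ∨-conicalˡ _ (someBad s) ok
            t′ , g≤t′ , e = does⇒ (realizable? (profile t)) (not-injective (∨-conicalˡ _ (someBad t) ok′))
        in subst (g ≤_) (¬bad⇒value t (∨-conicalʳ _ (someBad t) ok′) g≤t′ e) g≤t′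

      value : ∀ {x} → Dec (Realizable x) → Bool
      value (yes (t , _)) = does (onH α t ≟ʰ g)
      -- A forest of value `g` realizes its own profile, so an unrealizable profile excludes that
      -- value.
      value (no _)        = false

      hasValue-g : ∀ s → not (someBad s) ∧ value (realizable? (profile s)) ≡ does (onH α s ≟ʰ g)
      hasValue-g s with someBad s in ok | realizable? (profile s)
      ... | true  | _ = sym (dec-false (_ ≟ʰ g) λ { refl → contradiction (trans (sym ok) (above⇒¬bad s ≤-refl)) λ () })
      ... | false | yes (t , g≤t , e) = cong (λ h → does (h ≟ʰ g)) (¬bad⇒value s ok g≤t e)
      ... | false | no ¬r = sym (dec-false (_ ≟ʰ g) λ { refl → ¬r (s , ≤-refl , refl) })

      hasValue-g-definable : Definable λ s → does (onH α s ≟ʰ g)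
      hasValue-g-definable =
        Definable-map (λ (b , x) → not b ∧ value (realizable? x)) hasValue-g
          (Definable-× (Definable-someNode bad profile-definable) profile-definable)

  module Step (g : H F) (ih : ∀ h → h >[ g ] → Definable λ s → does (onH α s ≟ʰ h)) where

    n = proj₁ (IsFinite.H-finite fin)

    hasValue : Fin n → Forest A → Bool
    hasValue i s = does (_>?[_] fin (I.from i) g) ∧ does (onH α s ≟ʰ I.from i)

    hasValue-definable : ∀ i → Definable (hasValue i)
    hasValue-definable i = guarded (_>?[_] fin (I.from i) g)
      where
      guarded : (d : Dec (I.from i >[ g ])) → Definable λ s → does d ∧ does (onH α s ≟ʰ I.from i)
      guarded (yes i>g) = ih _ i>g
      guarded (no _)    = Definable-const false

    -- This encodes the label in α_Γ: a value strictly above `g` sets exactly its own bit, and the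
    -- vector without set bits stands for ∞.
    c : Forest A → Fin (2 ^ n)
    c s = funToFin λ i → bit (hasValue i s)

    c-definable : Definable c
    c-definable = Definable-funToFin n λ i → Definable-map bit (λ _ → refl) (hasValue-definable i)

    c-above : ∀ {s s′} → c s ≡ c s′ → onH α s >[ g ] → onH α s ≡ onH α s′
    c-above {s} {s′} e s>g = trans (sym s≡) (sym (does⇒ (_ ≟ʰ _)
      (trans (sym (has s′)) (trans (sym (bit-injective (funToFin-injective e i)))
        (trans (has s) (dec-true (_ ≟ʰ _) (sym s≡)))))))
      where
      i  = I.to (onH α s)
      s≡ : I.from i ≡ onH α s
      s≡ = I.strictlyInverseʳ (onH α s)
      has : ∀ t → hasValue i t ≡ does (onH α t ≟ʰ I.from i)
      has t = cong (_∧ does (onH α t ≟ʰ I.from i))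
                (dec-true (_>?[_] fin (I.from i) g) (subst (_>[ g ]) (sym s≡) s>g))

    -- One level is spent on the roots, leaving depth `k` for the child forests, as `determined`
    -- requires.
    open TypeCode (typeCode finA c-definable (suc k))
      renaming (code to τ; definable to τ-definable; sound to τ-sound)

    c⇒label : ∀ {s s′} → c s ≡ c s′ → EqualOn (quotientAt fin α g) s s′
    c⇒label {s} {s′} e = label-cases (_>?[_] fin (onH α s) g) (_>?[_] fin (onH α s′) g)
      where
      open AtClass fin g
      label-cases : Dec (onH α s >[ g ]) → Dec (onH α s′ >[ g ]) → [ onH α s ] ≡ [ onH α s′ ]
      label-cases (yes s>g) _          = cong [_] (c-above e s>g)
      label-cases (no _)    (yes s′>g) = cong [_] (sym (c-above (sym e) s′>g))
      label-cases (no s≯g)  (no s′≯g)  = trans ([]-∞ s≯g) (sym ([]-∞ s′≯g))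

    -- Equal labels strictly above the class are equal values. Otherwise both forests lie in the
    -- class of `g`, and nonconfusion applies.
    determined : ∀ {s s′} → g ≤ onH α s → g ≤ onH α s′ → c s ≡ c s′ →
                 Bisim (λ t t′ → c t ≡ c t′) k s s′ → onH α s ≡ onH α s′
    determined {s} {s′} g≤s g≤s′ e b with []-injective fin {g} (c⇒label e)
    ... | inj₁ s≡s′         = s≡s′
    ... | inj₂ (s≯g , s′≯g) = nonconfusing g s s′
      ( Bisim⇒∼ (quotientAt fin α g) k (Bisim-map c⇒label k b)
      , (≯⇒≤ fin g≤s s≯g , g≤s) , (≯⇒≤ fin g≤s′ s′≯g , g≤s′))

    profile : Forest A → Fin (2 ^ n * size)
    profile s = combine (c s) (τ s)

    profile-definable : Definable profile
    profile-definable = Definable-map (λ (x , y) → combine x y) (λ _ → refl) (Definable-× c-definable τ-definable)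

    profile-sound : ∀ {s s′} → profile s ≡ profile s′ →
                    Matched (λ t t′ → g ≤ onH α t → g ≤ onH α t′ → onH α t ≡ onH α t′) s s′
    profile-sound {s} {s′} e = Matched-map (λ (e , b) g≤t g≤t′ → determined g≤t g≤t′ e b)
      (proj₁ (τ-sound (proj₂ (combine-injective (c s) (τ s) (c s′) (τ s′) e))))

    open Recognition g profile-definable profile-sound

    definable : Definable λ s → does (onH α s ≟ʰ g)
    definable = hasValue-g-definable realizable?

  hasValue-definable : ∀ g → Definable λ s → does (onH α s ≟ʰ g)
  hasValue-definable g = go g (wellFounded g)
    where
    -- Accessibility for `_>[_]` refers to the values strictly above, so the induction runs from the
    -- top class downwards.
    wellFounded : WellFounded _>[_]
    wellFounded = Finite⇒wellFounded (IsFinite.H-finite fin) (λ (_ , ≇) → ≇ (≤-refl , ≤-refl))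
      λ h>g g>f → >-upward (proj₁ h>g) g>f
    go : ∀ g → Acc _>[_] g → Definable λ s → does (onH α s ≟ʰ g)
    go g (acc rec) = Step.definable g λ h h>g → go h (rec h>g)

  -- One product computes the tests for all values at once. The bit of `onH α s′` is set for `s′`,
  -- hence for `s` when the product identifies the two.
  nonconfusing⇒EFEX : EFEXHomomorphism α
  nonconfusing⇒EFEX = C.G , C.δ , C.product , λ s s′ e →
    let value≡ = λ i → bit-injective (funToFin-injective
                   (trans (sym (C.output-δ s)) (trans (cong C.output e) (C.output-δ s′))) i)
        s′≡ = I.strictlyInverseʳ (onH α s′)
    in trans (does⇒ (_ ≟ʰ _) (trans (value≡ (I.to (onH α s′))) (dec-true (_ ≟ʰ _) (sym s′≡)))) s′≡
    where
    module C = Computing (Definable-funToFin _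
      (λ i → Definable-map bit (λ _ → refl) (hasValue-definable (I.from i))) (trivial-product {A}))

theorem3 : (A : Set) → Finite (setoid A) →
    (F : ForestAlgebra) (fin : IsFinite F) →
    Commutative _≡_ (ForestAlgebra._+_ F) → Idempotent _≡_ (ForestAlgebra._+_ F) →
    (α : Hom (A ^Δ) F) → IsSurjective α →
    EFEXHomomorphism α ⇔ Nonconfusing fin α
theorem3 A finA F fin comm idem α surj = mk⇔ (EFEX⇒Nonconfusing fin α surj)
  λ (k , _ , nonconfusing) → nonconfusing⇒EFEX finA fin α semi k nonconfusing
  where
  semi : SemilatticeImage α
  semi = record
    { comm = λ s t → trans (onH-++ α s t) (trans (comm _ _) (sym (onH-++ α t s)))
    ; idem = λ s → trans (onH-++ α s s) (idem _)
    }
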